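{- Let $N\ge1$ and let $k_n,a_n,b_n,c_n,d_n$ ($1\le n\le N$) be real numbers with $0\le a_n<b_n$, $0\le c_n<d_n$, $k_n>0$ for every $n$, and $$\sum_{n=1}^N k_n(b_n-a_n)(d_n-c_n)=1.$$ Let $\pi_{\alpha_1},\pi_{\alpha_2}$ be random variables (the execution times of two algorithms) with joint density on $[0,\infty)\times[0,\infty)$ $$f(x,y)=\sum_{n=1}^N k_n\,\mathbf 1_{[a_n,b_n)}(x)\,\mathbf 1_{[c_n,d_n)}(y).$$ Then for every $\tau_1\ge 0$ the mean execution time $E\,T(\tau_1)$ of the derived algorithm (defined in the context) is $$\begin{aligned}E\,T(\tau_1)={}&\tau_1^2\Big(-\tfrac12\sum_{n:\,a_n<\tau_1<b_n}k_n(d_n-c_n)\Big)\\&+\tau_1\Big(\sum_{n:\,\tau_1\le a_n}k_n(b_n-a_n)(d_n-c_n)+\sum_{n:\,a_n<\tau_1<b_n}k_n\big(b_n-\tfrac12(d_n+c_n)\big)(d_n-c_n)\Big)\\&+\tfrac12\sum_{n:\,\tau_1\le a_n}k_n(b_n-a_n)(d_n^2-c_n^2)\\&+\tfrac12\sum_{n:\,a_n<\tau_1<b_n}k_n\big(b_n(d_n+c_n)-a_n^2\big)(d_n-c_n)\\&+\tfrac12\sum_{n:\,b_n\le\tau_1}k_n(b_n^2-a_n^2)(d_n-c_n),\end{aligned}$$ where each sum is over the indices $n\in\{1,\dots,N\}$ satisfying the indicated condition.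
   Context: For two algorithms $\alpha_1,\alpha_2$ with execution times $\pi_{\alpha_1},\pi_{\alpha_2}$, viewed as random variables on a probability space of tasks, and a time limit $\tau_1\ge0$, the derived algorithm runs $\alpha_1$ for time at most $\tau_1$ and, if it has not finished, abandons it and runs $\alpha_2$ to completion. Its execution time is the random variable $$T(\tau_1)=T_{\pi_{\alpha_1},\pi_{\alpha_2}}(\tau_1)=\begin{cases}\pi_{\alpha_1}&\text{if }\pi_{\alpha_1}\le\tau_1,\\ \tau_1+\pi_{\alpha_2}&\text{if }\tau_1<\pi_{\alpha_1}.\end{cases}$$ When the joint density of $(\pi_{\alpha_1},\pi_{\alpha_2})$ is $f$, its mean is $$E\,T(\tau_1)=\int_0^{\tau_1}\!\!\int_0^\infty x f(x,y)\,dy\,dx+\int_{\tau_1}^\infty\!\!\int_0^\infty(\tau_1+y)f(x,y)\,dy\,dx.$$ $\mathbf 1_A$ denotes the indicator function of $A$. Empty sums are $0$. -}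

module Defs where

open import Level using (Level; 0ℓ; _⊔_) renaming (suc to lsuc)
open import Algebra.Bundles using (CommutativeRing)
import Algebra.Properties.CommutativeMonoid.Sum as Sum
open import Data.Bool.Base using (if_then_else_)
open import Data.Fin.Base using (Fin; toℕ)
open import Data.Nat.Base as ℕ using (ℕ)
open import Data.Product.Base using (Σ-syntax; ∃; ∃-syntax; _×_)
open import Data.Unit.Base using (⊤)
open import Relation.Binary.Core using (Rel)
import Relation.Binary.Construct.NonStrictToStrict as ToStrict
open import Relation.Binary.Definitions using (Decidable)
open import Relation.Binary.PropositionalEquality.Core using (_≡_; _≢_)
open import Relation.Binary.Structures using (IsDecTotalOrder)
open import Relation.Nullary.Decidable.Core using (Dec; does)
open import Relation.Nullary.Negation.Core using (¬_)
import Relation.Unary as Unary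
open Unary using (Pred; Satisfiable; U; ∁; ⋃; _≐_)

record IsLub {c ℓ₁ ℓ₂} {A : Set c} (_≤_ : Rel A ℓ₁) (S : Pred A ℓ₂) (s : A)
             : Set (c ⊔ ℓ₁ ⊔ ℓ₂) where
  field
    upper : ∀ {x} → S x → x ≤ s
    least : ∀ {u} → (∀ {x} → S x → x ≤ u) → s ≤ u

-- The real numbers, as a Dedekind-complete ordered field (unique up to
-- isomorphism in classical mathematics).
record CompleteOrderedField : Set₁ where
  infix  4 _≤_
  infix  8 _⁻¹
  field
    commutativeRing : CommutativeRing 0ℓ 0ℓ

  open CommutativeRing commutativeRing public renaming (Carrier to ℝ)

  field
    0≉1             : ¬ (0# ≈ 1#)
    -- The value of 0# ⁻¹ is unspecified.
    _⁻¹             : ℝ → ℝ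
    ⁻¹-inverse      : ∀ x → ¬ (x ≈ 0#) → x * x ⁻¹ ≈ 1#
    _≤_             : Rel ℝ 0ℓ
    isDecTotalOrder : IsDecTotalOrder _≈_ _≤_
    +-monoʳ-≤       : ∀ x {y z} → y ≤ z → x + y ≤ x + z
    *-nonNeg        : ∀ {x y} → 0# ≤ x → 0# ≤ y → 0# ≤ x * y
    lub-exists      : (S : Pred ℝ 0ℓ) → Satisfiable S →
                      ∃[ u ] (∀ {x} → S x → x ≤ u) → ∃[ s ] IsLub _≤_ S s

  open IsDecTotalOrder isDecTotalOrder public using (_≟_; _≤?_)
  open ToStrict _≈_ _≤_ public using (_<_)
  open Sum +-commutativeMonoid public using (sum)

  infix 4 _<?_
  _<?_ : Decidable _<_
  _<?_ = ToStrict.<-decidable _≈_ _≤_ _≟_ _≤?_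

  ½ : ℝ
  ½ = (1# + 1#) ⁻¹

  infix 9 _²
  _² : ℝ → ℝ
  x ² = x * x

  indicator : ∀ {p} {P : Set p} → Dec P → ℝ
  indicator P? = if does P? then 1# else 0#

  -- sumWhere P? g = ∑ { g n | n satisfies P }.
  sumWhere : ∀ {N p} {P : Pred (Fin N) p} → Unary.Decidable P → (Fin N → ℝ) → ℝ
  sumWhere P? g = sum λ n → if does (P? n) then g n else 0#

  -- |x - y| < ε
  Within : ℝ → ℝ → ℝ → Set
  Within ε x y = x - y < ε × y - x < ε

  ConvergesTo : (ℕ → ℝ) → ℝ → Set
  ConvergesTo s l =
    ∀ ε → 0# < ε → ∃[ m ] (∀ n → m ℕ.≤ n → Within ε (s n) l)

module RiemannIntegral (ℛ : CompleteOrderedField) where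
  open CompleteOrderedField ℛ

  -- A tagged partition of [u, w]: `cell v t` splits off the subinterval
  -- [u, v] with tag t.
  data TaggedPartition (w : ℝ) : ℝ → Set where
    end  : ∀ {u} → u ≈ w → TaggedPartition w u
    cell : ∀ {u} v t → u ≤ t → t ≤ v → TaggedPartition w v → TaggedPartition w u

  riemannSum : (ℝ → ℝ) → ∀ {u w} → TaggedPartition w u → ℝ
  riemannSum f (end _)              = 0#
  riemannSum f (cell {u} v t _ _ p) = f t * (v - u) + riemannSum f p

  MeshBelow : ℝ → ∀ {u w} → TaggedPartition w u → Set
  MeshBelow δ (end _)              = ⊤
  MeshBelow δ (cell {u} v _ _ _ p) = v - u < δ × MeshBelow δ p

  -- f is Riemann integrable on [u, w] with integral I.
  HasIntegral : (ℝ → ℝ) → ℝ → ℝ → ℝ → Set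
  HasIntegral f u w I =
    ∀ ε → 0# < ε → ∃[ δ ] (0# < δ ×
      ((p : TaggedPartition w u) → MeshBelow δ p → Within ε (riemannSum f p) I))

  -- ∫ₓ from u to v of ∫ᵧ from s to t of f x y is I.
  HasIteratedIntegral : (ℝ → ℝ → ℝ) → (u v s t I : ℝ) → Set
  HasIteratedIntegral f u v s t I =
    ∃[ g ] ((∀ x → u ≤ x → x ≤ v → HasIntegral (f x) s t (g x))
            × HasIntegral g u v I)

record ProbabilitySpace (ℛ : CompleteOrderedField) (c ℓ : Level)
                        : Set (lsuc (c ⊔ ℓ ⊔ lsuc 0ℓ)) where
  open CompleteOrderedField ℛ
  field
    Ω            : Set c
    Measurable   : Pred Ω 0ℓ → Set ℓ
    measurable-≐ : ∀ {A B} → A ≐ B → Measurable A → Measurable B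
    measurable-U : Measurable U
    measurable-∁ : ∀ {A} → Measurable A → Measurable (∁ A)
    measurable-⋃ : ∀ {A : ℕ → Pred Ω 0ℓ} → (∀ n → Measurable (A n)) →
                   Measurable (⋃ ℕ A)

    -- Only the values on measurable events are constrained or used.
    ℙ            : Pred Ω 0ℓ → ℝ
    ℙ-cong       : ∀ {A B} → Measurable A → A ≐ B → ℙ A ≈ ℙ B
    ℙ-nonNeg     : ∀ {A} → Measurable A → 0# ≤ ℙ A
    ℙ-U          : ℙ U ≈ 1#
    ℙ-⋃          : ∀ {A : ℕ → Pred Ω 0ℓ} → (∀ n → Measurable (A n)) →
                   (∀ {m n} → m ≢ n → ∀ {ω} → A m ω → ¬ A n ω) →
                   ConvergesTo (λ n → sum {n} λ i → ℙ (A (toℕ i))) (ℙ (⋃ ℕ A))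

module Probability {ℛ : CompleteOrderedField} {c ℓ} (𝒫 : ProbabilitySpace ℛ c ℓ) where
  open CompleteOrderedField ℛ
  open RiemannIntegral ℛ
  open ProbabilitySpace 𝒫

  IsRandomVariable : (Ω → ℝ) → Set ℓ
  IsRandomVariable X = ∀ t → Measurable λ ω → X ω ≤ t

  -- (X , Y) has joint density f on [0,∞) × [0,∞):
  -- P (u ≤ X ≤ v , s ≤ Y ≤ t) = ∫ᵤᵛ ∫ₛᵗ f x y dy dx.
  HasJointDensity : (X Y : Ω → ℝ) → (ℝ → ℝ → ℝ) → Set
  HasJointDensity X Y f =
    ∀ {u v s t} → 0# ≤ u → u ≤ v → 0# ≤ s → s ≤ t →
    HasIteratedIntegral f u v s t
      (ℙ λ ω → (u ≤ X ω × X ω ≤ v) × (s ≤ Y ω × Y ω ≤ t))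

  -- A nonnegative simple function, given by its values on the pieces of a
  -- finite measurable partition of Ω.
  record SimpleFunction : Set (c ⊔ ℓ ⊔ lsuc 0ℓ) where
    field
      size       : ℕ
      piece      : Fin size → Pred Ω 0ℓ
      measurable : ∀ i → Measurable (piece i)
      covering   : ∀ ω → ∃[ i ] piece i ω
      disjoint   : ∀ {i j ω} → piece i ω → piece j ω → i ≡ j
      value      : Fin size → ℝ
      nonNeg     : ∀ i → 0# ≤ value i

    integral : ℝ
    integral = sum λ i → value i * ℙ (piece i)

    Below : (Ω → ℝ) → Set c
    Below X = ∀ {i ω} → piece i ω → value i ≤ X ω

  open SimpleFunction using (integral; Below)

  -- E X = e, as a Lebesgue integral; for nonnegative X with finite mean.
  record HasExpectation (X : Ω → ℝ) (e : ℝ) : Set (c ⊔ ℓ ⊔ lsuc 0ℓ) where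
    field
      isRandomVariable : IsRandomVariable X
      nonNegative      : ∀ ω → 0# ≤ X ω
      isLub            : IsLub _≤_
        (λ s → Σ[ φ ∈ SimpleFunction ] (Below φ X × s ≈ integral φ)) e

  -- Run the first algorithm for time at most τ; if it has not finished, run
  -- the second one to completion.
  derivedTime : (π₁ π₂ : Ω → ℝ) (τ : ℝ) → Ω → ℝ
  derivedTime π₁ π₂ τ ω = if does (π₁ ω ≤? τ) then π₁ ω else τ + π₂ ω

{-# OPTIONS --safe #-}

-- The mean of T ≥ 0 is the Stieltjes integral ∫ x dF of its distribution
-- function F, and it is enough to exhibit H with
--   s (F t - F s) ≤ H t - H s ≤ t (F t - F s)   for 0 ≤ s ≤ t:
-- comparing simple functions with H along fine partitions gives
-- E T = H M - H 0 as soon as P (T ≤ M) = 1.  Integrating the density over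
-- rectangles expresses P (π₁ ≤ v, π₂ ≤ t) through the clipped identities
-- max aₙ (min v bₙ) and max cₙ (min t dₙ), hence F is a positive combination,
-- up to a constant, of functions p which either stay constant or coincide
-- with the identity.  For such p one has ∫ x dp = ½ p², which gives H.
module Submission where

-- The density evaluates only iterated Riemann integrals over bounded rectangles, whereas the mean
-- is a supremum over simple functions on `Ω`; nothing given links an integral against the density
-- to a mean. The distribution function of `T` is the bridge: `{T ≤ t}` splits into `{π₁ ≤ min t τ}`
-- and `{π₁ > τ, π₂ ≤ t - τ}`, and these become rectangles or differences of rectangles once the
-- null set outside a large square is discarded. That such a square has probability one follows from
-- the normalisation of the density, and its side also provides M.
--
-- The two halves of the bound on H have separate roles. The upper one shows that the staircase
-- under T over a partition of [0, M] with mesh δ integrates to at least H M - H 0 - δ. The lower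
-- one shows that a simple function below T has integral at most H M - H 0 + δ. Letting δ vanish
-- identifies the supremum, with no limit theorem for integrals.

open import Defs
open import Level using (0ℓ)
open import Axiom.ExcludedMiddle using (ExcludedMiddle)
open import Data.Fin.Base using (Fin; zero; suc)
open import Data.Nat.Base as ℕ using (ℕ; zero; suc)
open import Data.Product.Base using (_×_; _,_; proj₁; proj₂; ∃-syntax; Σ-syntax)
open import Relation.Nullary.Decidable using (_×-dec_)

open import Algebra.Bundles using (CommutativeRing)
import Algebra.Solver.Ring as RingSolver
open import Algebra.Solver.Ring.AlmostCommutativeRing
  using (fromCommutativeRing; _-Raw-AlmostCommutative⟶_)
open import Data.Bool.Base using (if_then_else_)
open import Data.Empty using (⊥-elim)
open import Data.Fin.Properties using (suc-injective; ¬Fin0)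
open import Data.Integer.Base as ℤ using (ℤ; +_; -[1+_])
import Data.Integer.Properties as ℤ
open import Data.Maybe.Base as Maybe using (Maybe)
import Data.Nat.Properties as ℕ
open import Data.Sign.Base as Sign using (Sign)
open import Data.Sum.Base using (_⊎_; inj₁; inj₂)
open import Data.Unit.Base using (tt)
open import Function.Base using (_∘_)
open import Relation.Binary.Bundles using (DecTotalOrder)
import Relation.Binary.Construct.NonStrictToStrict as ToStrict
open import Relation.Binary.PropositionalEquality.Core as ≡ using (_≡_; _≢_)
open import Relation.Binary.Structures using (IsDecTotalOrder)
open import Relation.Nullary.Decidable.Core using (Dec; yes; no; does; dec⇒maybe; decidable-stable)
open import Relation.Nullary.Negation.Core using (¬_)
open import Relation.Unary using (Pred; U; ∁; ⋃; ∅; _∩_; _∪_; _≐_; _⊆_)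

-- The solver must decide equality of coefficients, which elements of an
-- abstract ring do not allow; hence coefficients in ℤ.
module IntegerSolver {c ℓ} (R : CommutativeRing c ℓ) where
  open CommutativeRing R
  open import Algebra.Properties.Ring ring
    using (-‿distribˡ-*; -‿distribʳ-*; -0#≈0#; -‿involutive)
  open import Algebra.Properties.AbelianGroup +-abelianGroup using (⁻¹-∙-comm)
  open import Algebra.Properties.Semiring.Mult.TCOptimised semiring
    using (1+×; ×-homo-+; ×1-homo-*) renaming (_×_ to _·_)
  open import Relation.Binary.Reasoning.Setoid setoid

  ⟦_⟧ : ℤ → Carrier
  ⟦ + n ⟧      = n · 1#
  ⟦ -[1+ n ] ⟧ = - (suc n · 1#)

  private
    cancel : ∀ x y z → (x + y) - (x + z) ≈ y - z
    cancel x y z = begin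
      (x + y) + - (x + z)     ≈⟨ +-cong (+-comm x y) (sym (⁻¹-∙-comm x z)) ⟩
      (y + x) + (- x + - z)   ≈⟨ +-assoc y x _ ⟩
      y + (x + (- x + - z))   ≈⟨ +-congˡ (+-assoc x (- x) (- z)) ⟨
      y + ((x + - x) + - z)   ≈⟨ +-congˡ (+-congʳ (-‿inverseʳ x)) ⟩
      y + (0# + - z)          ≈⟨ +-congˡ (+-identityˡ (- z)) ⟩
      y + - z                 ∎

    ⊖-homo : ∀ m n → ⟦ m ℤ.⊖ n ⟧ ≈ m · 1# - n · 1#
    ⊖-homo zero    zero    = sym (-‿inverseʳ 0#)
    ⊖-homo zero    (suc n) = sym (+-identityˡ _)
    ⊖-homo (suc m) zero    = sym (trans (+-congˡ -0#≈0#) (+-identityʳ _))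
    ⊖-homo (suc m) (suc n) = begin
      ⟦ suc m ℤ.⊖ suc n ⟧               ≡⟨ ≡.cong ⟦_⟧ (ℤ.[1+m]⊖[1+n]≡m⊖n m n) ⟩
      ⟦ m ℤ.⊖ n ⟧                       ≈⟨ ⊖-homo m n ⟩
      m · 1# - n · 1#                   ≈⟨ cancel 1# _ _ ⟨
      (1# + m · 1#) - (1# + n · 1#)     ≈⟨ +-cong (1+× m 1#) (-‿cong (1+× n 1#)) ⟨
      suc m · 1# - suc n · 1#           ∎

    ◃⁺ : ∀ n → ⟦ Sign.+ ℤ.◃ n ⟧ ≈ n · 1#
    ◃⁺ zero    = refl
    ◃⁺ (suc n) = refl

    ◃⁻ : ∀ n → ⟦ Sign.- ℤ.◃ n ⟧ ≈ - (n · 1#)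
    ◃⁻ zero    = sym -0#≈0#
    ◃⁻ (suc n) = refl

    +-homo : ∀ i j → ⟦ i ℤ.+ j ⟧ ≈ ⟦ i ⟧ + ⟦ j ⟧
    +-homo (+ m)    (+ n)    = ×-homo-+ 1# m n
    +-homo (+ m)    -[1+ n ] = ⊖-homo m (suc n)
    +-homo -[1+ m ] (+ n)    = trans (⊖-homo n (suc m)) (+-comm _ _)
    +-homo -[1+ m ] -[1+ n ] = begin
      - (suc (suc (m ℕ.+ n)) · 1#)              ≈⟨ -‿cong (1+× (suc (m ℕ.+ n)) 1#) ⟩
      - (1# + (suc m ℕ.+ n) · 1#)               ≈⟨ -‿cong (+-congˡ (×-homo-+ 1# (suc m) n)) ⟩
      - (1# + (suc m · 1# + n · 1#))            ≈⟨ -‿cong (+-assoc 1# _ _) ⟨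
      - ((1# + suc m · 1#) + n · 1#)            ≈⟨ -‿cong (+-congʳ (+-comm 1# _)) ⟩
      - ((suc m · 1# + 1#) + n · 1#)            ≈⟨ -‿cong (+-assoc _ 1# _) ⟩
      - (suc m · 1# + (1# + n · 1#))            ≈⟨ -‿cong (+-congˡ (1+× n 1#)) ⟨
      - (suc m · 1# + suc n · 1#)               ≈⟨ ⁻¹-∙-comm _ _ ⟨
      - (suc m · 1#) - suc n · 1#               ∎

    *-homo : ∀ i j → ⟦ i ℤ.* j ⟧ ≈ ⟦ i ⟧ * ⟦ j ⟧
    *-homo (+ m)    (+ n)    = trans (◃⁺ (m ℕ.* n)) (×1-homo-* m n)
    *-homo (+ m)    -[1+ n ] = begin
      ⟦ Sign.- ℤ.◃ m ℕ.* suc n ⟧     ≈⟨ ◃⁻ (m ℕ.* suc n) ⟩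
      - ((m ℕ.* suc n) · 1#)         ≈⟨ -‿cong (×1-homo-* m (suc n)) ⟩
      - (m · 1# * suc n · 1#)        ≈⟨ -‿distribʳ-* _ _ ⟩
      m · 1# * - (suc n · 1#)        ∎
    *-homo -[1+ m ] (+ n)    = begin
      ⟦ Sign.- ℤ.◃ suc m ℕ.* n ⟧     ≈⟨ ◃⁻ (suc m ℕ.* n) ⟩
      - ((suc m ℕ.* n) · 1#)         ≈⟨ -‿cong (×1-homo-* (suc m) n) ⟩
      - (suc m · 1# * n · 1#)        ≈⟨ -‿distribˡ-* _ _ ⟩
      - (suc m · 1#) * n · 1#        ∎
    *-homo -[1+ m ] -[1+ n ] = begin
      (suc m ℕ.* suc n) · 1#             ≈⟨ ×1-homo-* (suc m) (suc n) ⟩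
      suc m · 1# * suc n · 1#            ≈⟨ -‿involutive _ ⟨
      - - (suc m · 1# * suc n · 1#)      ≈⟨ -‿cong (-‿distribˡ-* _ _) ⟩
      - (- (suc m · 1#) * suc n · 1#)    ≈⟨ -‿distribʳ-* _ _ ⟩
      - (suc m · 1#) * - (suc n · 1#)    ∎

    -‿homo : ∀ i → ⟦ ℤ.- i ⟧ ≈ - ⟦ i ⟧
    -‿homo (+ zero)  = sym -0#≈0#
    -‿homo (+ suc n) = refl
    -‿homo -[1+ n ]  = sym (-‿involutive _)

    morphism : ℤ.+-*-rawRing -Raw-AlmostCommutative⟶ fromCommutativeRing R
    morphism = record
      { ⟦_⟧ = ⟦_⟧ ; +-homo = +-homo ; *-homo = *-homo ; -‿homo = -‿homo
      ; 0-homo = refl ; 1-homo = refl }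

    coeff≟ : ∀ i j → Maybe (⟦ i ⟧ ≈ ⟦ j ⟧)
    coeff≟ i j = Maybe.map (λ i≡j → reflexive (≡.cong ⟦_⟧ i≡j)) (dec⇒maybe (i ℤ.≟ j))

  open RingSolver ℤ.+-*-rawRing (fromCommutativeRing R) morphism coeff≟ public
    using (solve; _:=_; _:+_; _:*_; _:-_; :-_; con)

-- Inequalities and finite sums in an ordered field

module OrderedField (ℛ : CompleteOrderedField) where
  open CompleteOrderedField ℛ hiding (zero)
  open IntegerSolver commutativeRing


  module ≤ = IsDecTotalOrder isDecTotalOrder

  decTotalOrder : DecTotalOrder 0ℓ 0ℓ 0ℓ
  decTotalOrder = record { isDecTotalOrder = isDecTotalOrder }

  open import Algebra.Construct.NaturalChoice.Min (DecTotalOrder.totalOrder decTotalOrder) public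
  open import Algebra.Construct.NaturalChoice.Max (DecTotalOrder.totalOrder decTotalOrder) public
  open import Relation.Binary.Reasoning.PartialOrder (DecTotalOrder.poset decTotalOrder)

  <⇒≱ : ∀ {x y} → x < y → ¬ (y ≤ x)
  <⇒≱ = ToStrict.<⇒≱ _≈_ _≤_ ≤.antisym

  ≰⇒> : ∀ {x y} → ¬ (x ≤ y) → y < x
  ≰⇒> = ToStrict.≰⇒> _≈_ _≤_ sym ≤.reflexive ≤.total

  ≤-<-trans : ∀ {x y z} → x ≤ y → y < z → x < z
  ≤-<-trans x≤y y<z = ≤.trans x≤y (proj₁ y<z) ,
    λ x≈z → <⇒≱ y<z (≤.trans (≤.reflexive (sym x≈z)) x≤y)

  <-≤-trans : ∀ {x y z} → x < y → y ≤ z → x < z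
  <-≤-trans x<y y≤z = ≤.trans (proj₁ x<y) y≤z ,
    λ x≈z → <⇒≱ x<y (≤.trans y≤z (≤.reflexive (sym x≈z)))

  0≤y-x : ∀ {x y} → x ≤ y → 0# ≤ y - x
  0≤y-x {x} {y} x≤y = begin
    0#      ≈⟨ -‿inverseˡ x ⟨
    - x + x ≤⟨ +-monoʳ-≤ (- x) x≤y ⟩
    - x + y ≈⟨ +-comm (- x) y ⟩
    y - x   ∎

  ≤-from-gap : ∀ {x y d} → 0# ≤ d → y - x ≈ d → x ≤ y
  ≤-from-gap {x} {y} {d} 0≤d eq = begin
    x            ≈⟨ +-identityʳ x ⟨
    x + 0#       ≤⟨ +-monoʳ-≤ x 0≤d ⟩
    x + d        ≈⟨ +-congˡ eq ⟨
    x + (y - x)  ≈⟨ solve 2 (λ x y → x :+ (y :- x) := y) refl x y ⟩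
    y            ∎

  x-y≤0⇒x≤y : ∀ {x y} → x - y ≤ 0# → x ≤ y
  x-y≤0⇒x≤y {x} {y} x-y≤0 = ≤-from-gap (0≤y-x x-y≤0)
    (solve 2 (λ x y → y :- x := con (+ 0) :- (x :- y)) refl x y)

  +-nonNeg : ∀ {x y} → 0# ≤ x → 0# ≤ y → 0# ≤ x + y
  +-nonNeg {x} {y} 0≤x 0≤y = begin
    0#     ≤⟨ 0≤x ⟩
    x      ≈⟨ +-identityʳ x ⟨
    x + 0# ≤⟨ +-monoʳ-≤ x 0≤y ⟩
    x + y  ∎

  +-mono-≤ : ∀ {x y z w} → x ≤ y → z ≤ w → x + z ≤ y + w
  +-mono-≤ {x} {y} {z} {w} x≤y z≤w = ≤-from-gap (+-nonNeg (0≤y-x x≤y) (0≤y-x z≤w))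
    (solve 4 (λ x y z w → (y :+ w) :- (x :+ z) := (y :- x) :+ (w :- z)) refl x y z w)

  neg-mono-≤ : ∀ {x y} → x ≤ y → - y ≤ - x
  neg-mono-≤ {x} {y} x≤y = ≤-from-gap (0≤y-x x≤y)
    (solve 2 (λ x y → (:- x) :- (:- y) := y :- x) refl x y)

  -‿mono-≤ : ∀ {x y z w} → x ≤ y → w ≤ z → x - z ≤ y - w
  -‿mono-≤ x≤y w≤z = +-mono-≤ x≤y (neg-mono-≤ w≤z)

  *-monoˡ-≤ : ∀ {x y z} → 0# ≤ z → x ≤ y → z * x ≤ z * y
  *-monoˡ-≤ {x} {y} {z} 0≤z x≤y = ≤-from-gap (*-nonNeg 0≤z (0≤y-x x≤y))
    (solve 3 (λ x y z → z :* y :- z :* x := z :* (y :- x)) refl x y z)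

  *-monoʳ-≤ : ∀ {x y z} → 0# ≤ z → x ≤ y → x * z ≤ y * z
  *-monoʳ-≤ {x} {y} {z} 0≤z x≤y = ≤-from-gap (*-nonNeg 0≤z (0≤y-x x≤y))
    (solve 3 (λ x y z → y :* z :- x :* z := z :* (y :- x)) refl x y z)

  x≤x+y : ∀ {x y} → 0# ≤ y → x ≤ x + y
  x≤x+y {x} {y} 0≤y = ≤-from-gap 0≤y (solve 2 (λ x y → (x :+ y) :- x := y) refl x y)

  x-y≤x : ∀ {x y} → 0# ≤ y → x - y ≤ x
  x-y≤x {x} {y} 0≤y = ≤-from-gap 0≤y (solve 2 (λ x y → x :- (x :- y) := y) refl x y)

  square-nonNeg : ∀ x → 0# ≤ x * x
  square-nonNeg x with ≤.total 0# x
  ... | inj₁ 0≤x = *-nonNeg 0≤x 0≤x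
  ... | inj₂ x≤0 = begin
    0#                    ≤⟨ *-nonNeg (0≤y-x x≤0) (0≤y-x x≤0) ⟩
    (0# - x) * (0# - x)   ≈⟨ solve 1 (λ x → (con (+ 0) :- x) :* (con (+ 0) :- x) := x :* x) refl x ⟩
    x * x                 ∎

  0≤1 : 0# ≤ 1#
  0≤1 = begin 0# ≤⟨ square-nonNeg 1# ⟩ 1# * 1# ≈⟨ *-identityˡ 1# ⟩ 1# ∎

  0<1 : 0# < 1#
  0<1 = 0≤1 , 0≉1

  *-pos : ∀ {x y} → 0# < x → 0# < y → 0# < x * y
  *-pos {x} {y} (0≤x , 0≉x) (0≤y , 0≉y) = *-nonNeg 0≤x 0≤y , λ 0≈xy → 0≉x (begin-equality
    0#               ≈⟨ zeroˡ (y ⁻¹) ⟨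
    0# * y ⁻¹        ≈⟨ *-congʳ 0≈xy ⟩
    (x * y) * y ⁻¹   ≈⟨ *-assoc x y (y ⁻¹) ⟩
    x * (y * y ⁻¹)   ≈⟨ *-congˡ (⁻¹-inverse y (λ y≈0 → 0≉y (sym y≈0))) ⟩
    x * 1#           ≈⟨ *-identityʳ x ⟩
    x                ∎)

  0<x+1 : ∀ {x} → 0# ≤ x → 0# < x + 1#
  0<x+1 {x} 0≤x = +-nonNeg 0≤x 0≤1 , λ eq →
    <⇒≱ 0<1 (begin 1#
      ≤⟨ ≤-from-gap 0≤x (solve 1 (λ x → (x :+ con (+ 1)) :- con (+ 1) :=
           x) refl x) ⟩ x + 1# ≈⟨ eq ⟨ 0# ∎)

  ⁻¹-pos : ∀ {x} → 0# < x → 0# < x ⁻¹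
  ⁻¹-pos {x} (0≤x , 0≉x) = ≰⇒> λ x⁻¹≤0 → <⇒≱ 0<1 (begin
    1#         ≈⟨ ⁻¹-inverse x (λ x≈0 → 0≉x (sym x≈0)) ⟨
    x * x ⁻¹   ≤⟨ *-monoˡ-≤ 0≤x x⁻¹≤0 ⟩
    x * 0#     ≈⟨ zeroʳ x ⟩
    0#         ∎)

  -- Stands in for passing to the limit: the approximation arguments below leave an error `K * ε`
  -- with `ε` arbitrary.
  ≤-vanishing : ∀ {K x} → 0# ≤ K → (∀ ε → 0# < ε → x ≤ K * ε) → x ≤ 0#
  ≤-vanishing {K} {x} 0≤K bound with x ≤? 0#
  ... | yes x≤0 = x≤0
  ... | no x≰0 = ⊥-elim (<⇒≱ 0<ε (≤-from-gap (0≤y-x (bound ε 0<ε)) (begin-equality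
      0# - ε
        ≈⟨ solve 2 (λ K ε → con (+ 0) :- ε := K :* ε :- (K :+ con (+ 1)) :* ε) refl K ε ⟩
      K * ε - K+1 * ε     ≈⟨ +-congˡ (-‿cong K+1*ε≈x) ⟩
      K * ε - x           ∎)))
    where
    K+1 = K + 1#
    0<K+1 = 0<x+1 0≤K
    -- Dividing by `K + 1` allows `K` to be zero; `x` is then `K * ε + ε`, which exceeds `K * ε`.
    ε = x * K+1 ⁻¹
    0<ε : 0# < ε
    0<ε = *-pos (≰⇒> x≰0) (⁻¹-pos 0<K+1)
    K+1*ε≈x : K+1 * ε ≈ x
    K+1*ε≈x = begin-equality
      K+1 * (x * K+1 ⁻¹)  ≈⟨ solve 3 (λ k x i → k :* (x :* i) := x :* (k :* i)) refl K+1 x (K+1 ⁻¹) ⟩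
      x * (K+1 * K+1 ⁻¹)  ≈⟨ *-congˡ (⁻¹-inverse K+1 (λ e → proj₂ 0<K+1 (sym e))) ⟩
      x * 1#              ≈⟨ *-identityʳ x ⟩
      x                   ∎

  ≈-from-both : ∀ {x y K} → 0# ≤ K →
    (∀ ε → 0# < ε → x - y ≤ K * ε × y - x ≤ K * ε) → x ≈ y
  ≈-from-both 0≤K close = ≤.antisym
    (x-y≤0⇒x≤y (≤-vanishing 0≤K λ ε 0<ε → proj₁ (close ε 0<ε)))
    (x-y≤0⇒x≤y (≤-vanishing 0≤K λ ε 0<ε → proj₂ (close ε 0<ε)))

  0<½ : 0# < ½
  0<½ = ⁻¹-pos (0<x+1 0≤1)

  ½+½≈1 : ½ + ½ ≈ 1#
  ½+½≈1 = begin-equality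
    ½ + ½            ≈⟨ solve 1 (λ h → h :+ h := (con (+ 1) :+ con (+ 1)) :* h) refl ½ ⟩
    (1# + 1#) * ½    ≈⟨ ⁻¹-inverse (1# + 1#) (λ e → proj₂ (0<x+1 0≤1) (sym e)) ⟩
    1#               ∎

  -- The ring solver treats ½ as a variable, so factors ½ + ½ are inserted by hand.
  ½-twice : ∀ x → (½ + ½) * x ≈ x
  ½-twice x = trans (*-congʳ ½+½≈1) (*-identityˡ x)

  sum-cong : ∀ {n} {f g : Fin n → ℝ} → (∀ i → f i ≈ g i) → sum f ≈ sum g
  sum-cong {zero}  f≈g = refl
  sum-cong {suc n} f≈g = +-cong (f≈g zero) (sum-cong (λ i → f≈g (suc i)))

  sum-zero : ∀ {n} {f : Fin n → ℝ} → (∀ i → f i ≈ 0#) → sum f ≈ 0#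
  sum-zero {zero}  f≈0 = refl
  sum-zero {suc n} f≈0 = trans (+-cong (f≈0 zero) (sum-zero (f≈0 ∘ suc))) (+-identityˡ 0#)

  sum-mono : ∀ {n} {f g : Fin n → ℝ} → (∀ i → f i ≤ g i) → sum f ≤ sum g
  sum-mono {zero}  f≤g = ≤.refl
  sum-mono {suc n} f≤g = +-mono-≤ (f≤g zero) (sum-mono (λ i → f≤g (suc i)))

  sum-nonNeg : ∀ {n} {f : Fin n → ℝ} → (∀ i → 0# ≤ f i) → 0# ≤ sum f
  sum-nonNeg {zero}  0≤f = ≤.refl
  sum-nonNeg {suc n} 0≤f = +-nonNeg (0≤f zero) (sum-nonNeg (λ i → 0≤f (suc i)))

  sum-sub : ∀ {n} (f g : Fin n → ℝ) → sum (λ i → f i - g i) ≈ sum f - sum g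
  sum-sub {zero}  f g = sym (-‿inverseʳ 0#)
  sum-sub {suc n} f g = begin-equality
    (f zero - g zero) + sum (λ i → f (suc i) - g (suc i))
      ≈⟨ +-congˡ (sum-sub (λ i → f (suc i)) (λ i → g (suc i))) ⟩
    (f zero - g zero) + (sum (λ i → f (suc i)) - sum (λ i → g (suc i)))
      ≈⟨ solve 4 (λ a b c d → (a :- b) :+ (c :- d) := (a :+ c) :- (b :+ d)) refl
           (f zero) (g zero) (sum (λ i → f (suc i))) (sum (λ i → g (suc i))) ⟩
    (f zero + sum (λ i → f (suc i))) - (g zero + sum (λ i → g (suc i))) ∎

  term≤sum : ∀ {n} {f : Fin n → ℝ} → (∀ i → 0# ≤ f i) → ∀ i → f i ≤ sum f
  term≤sum {suc n} {f} 0≤f zero    = x≤x+y (sum-nonNeg (λ i → 0≤f (suc i)))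
  term≤sum {suc n} {f} 0≤f (suc i) = begin
    f (suc i)                          ≤⟨ term≤sum (λ j → 0≤f (suc j)) i ⟩
    sum (λ j → f (suc j))              ≤⟨ x≤x+y (0≤f zero) ⟩
    sum (λ j → f (suc j)) + f zero     ≈⟨ +-comm _ _ ⟩
    sum f                              ∎

  if-yes : ∀ {p} {P : Set p} (P? : Dec P) {x y : ℝ} → P → (if does P? then x else y) ≈ x
  if-yes (yes _) p = refl
  if-yes (no ¬p) p = ⊥-elim (¬p p)

  if-no : ∀ {p} {P : Set p} (P? : Dec P) {x y : ℝ} → ¬ P → (if does P? then x else y) ≈ y
  if-no (yes p) ¬p = ⊥-elim (¬p p)
  if-no (no _)  ¬p = refl

-- Fine partitions and uniqueness of the Riemann integral

module RiemannSums (em : ExcludedMiddle 0ℓ) (ℛ : CompleteOrderedField) where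
  open CompleteOrderedField ℛ hiding (zero)
  open RiemannIntegral ℛ
  open IntegerSolver commutativeRing
  open OrderedField ℛ
  open import Algebra.Properties.Monoid.Mult +-monoid using () renaming (_×_ to _·_)
  open import Relation.Binary.Reasoning.PartialOrder (DecTotalOrder.poset decTotalOrder)

  -- If all multiples of `h` stayed below `x`, their supremum `σ` would bound the successor of every
  -- multiple, so `σ - h` would be an upper bound too, against `0# < h`.
  archimedean : ∀ {h} → 0# < h → ∀ x → ∃[ n ] x ≤ n · h
  archimedean {h} 0<h x with em {P = ∃[ n ] x ≤ n · h}
  ... | yes found = found
  ... | no none = ⊥-elim (<⇒≱ 0<h (≤-from-gap (0≤y-x σ≤σ-h)
      (solve 2 (λ σ h → con (+ 0) :- h := (σ :- h) :- σ) refl σ h)))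
    where
    Multiple : Pred ℝ 0ℓ
    Multiple y = ∃[ n ] y ≈ n · h

    bounded : ∀ {y} → Multiple y → y ≤ x
    bounded {y} (n , y≈nh) with ≤.total x (n · h)
    ... | inj₁ x≤nh = ⊥-elim (none (n , x≤nh))
    ... | inj₂ nh≤x = ≤.trans (≤.reflexive y≈nh) nh≤x

    supremum = lub-exists Multiple (0# , 0 , refl) (x , bounded)
    σ = proj₁ supremum
    open IsLub (proj₂ supremum)

    σ≤σ-h : σ ≤ σ - h
    σ≤σ-h = least λ { {y} (n , y≈nh) → ≤-from-gap (0≤y-x (upper (suc n , refl)))
      (begin-equality
        (σ - h) - y        ≈⟨ +-congˡ (-‿cong y≈nh) ⟩
        (σ - h) - n · h    ≈⟨ solve 3 (λ σ h z → (σ :- h) :- z := σ :- (h :+ z)) refl σ h (n · h) ⟩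
        σ - (h + n · h)    ∎) }

  endpoints-ordered : ∀ {u w} → TaggedPartition w u → u ≤ w
  endpoints-ordered (end u≈w)            = ≤.reflexive u≈w
  endpoints-ordered (cell v t u≤t t≤v p) = ≤.trans u≤t (≤.trans t≤v (endpoints-ordered p))

  meshBelow-mono : ∀ {δ ε u w} → δ ≤ ε → (p : TaggedPartition w u) → MeshBelow δ p → MeshBelow ε p
  meshBelow-mono δ≤ε (end _)          _              = tt
  meshBelow-mono δ≤ε (cell _ _ _ _ p) (small , rest) = <-≤-trans small δ≤ε , meshBelow-mono δ≤ε p rest

  -- Keeps `HasIntegral` from holding vacuously; every passage to mesh zero below starts from such a
  -- partition.
  partition-exists : ∀ {δ} → 0# < δ → ∀ {u w} → u ≤ w → ∃[ p ] MeshBelow δ {u} {w} p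
  partition-exists {δ} 0<δ {u} {w} u≤w = go (proj₁ count) u≤w (proj₂ count)
    where
    -- `MeshBelow` is strict, so cells of length `δ` itself would be too long.
    h = ½ * δ
    0<h : 0# < h
    0<h = *-pos 0<½ 0<δ
    h+h≈δ : h + h ≈ δ
    h+h≈δ = begin-equality
      ½ * δ + ½ * δ  ≈⟨ distribʳ δ ½ ½ ⟨
      (½ + ½) * δ    ≈⟨ *-congʳ ½+½≈1 ⟩
      1# * δ         ≈⟨ *-identityˡ δ ⟩
      δ              ∎
    count = archimedean 0<h (w - u)
    h<δ : h < δ
    h<δ = ≰⇒> λ δ≤h → <⇒≱ 0<h (≤-from-gap (0≤y-x δ≤h) (begin-equality
      0# - h         ≈⟨ solve 1 (λ h → con (+ 0) :- h := h :- (h :+ h)) refl h ⟩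
      h - (h + h)    ≈⟨ +-congˡ (-‿cong h+h≈δ) ⟩
      h - δ          ∎))
    go : ∀ n {u} → u ≤ w → w - u ≤ n · h → ∃[ p ] MeshBelow δ {u} {w} p
    go zero {u} u≤w w-u≤0 = end (≤.antisym u≤w (≤-from-gap (0≤y-x w-u≤0)
      (solve 2 (λ u w → u :- w := con (+ 0) :- (w :- u)) refl u w))) , tt
    go (suc n) {u} u≤w w-u≤[1+n]h with ≤.total w (u + h)
    ... | inj₁ w≤u+h = cell w w u≤w ≤.refl (end refl) ,
      ≤-<-trans (≤-from-gap (0≤y-x w≤u+h)
        (solve 3 (λ u w h → h :- (w :- u) := (u :+ h) :- w) refl u w h)) h<δ , tt
    ... | inj₂ u+h≤w = cell (u + h) u ≤.refl (x≤x+y (proj₁ 0<h)) (proj₁ rest) ,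
      ≤-<-trans (≤.reflexive (solve 2 (λ u h → (u :+ h) :- u := h) refl u h)) h<δ , proj₂ rest
      where
      rest = go n u+h≤w (≤-from-gap (0≤y-x w-u≤[1+n]h)
        (solve 4 (λ u w h z → z :- (w :- (u :+ h)) := (h :+ z) :- (w :- u)) refl u w h (n · h)))

  riemannSum-cong : ∀ {f g u w} (p : TaggedPartition w u) →
    (∀ x → u ≤ x → x ≤ w → f x ≈ g x) → riemannSum f p ≈ riemannSum g p
  riemannSum-cong (end _) f≈g = refl
  riemannSum-cong (cell v t u≤t t≤v p) f≈g = +-cong
    (*-congʳ (f≈g t u≤t (≤.trans t≤v (endpoints-ordered p))))
    (riemannSum-cong p λ x v≤x → f≈g x (≤.trans u≤t (≤.trans t≤v v≤x)))

  riemannSum-sub : ∀ f g {u w} (p : TaggedPartition w u) →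
    riemannSum (λ x → f x - g x) p ≈ riemannSum f p - riemannSum g p
  riemannSum-sub f g (end _) = sym (-‿inverseʳ 0#)
  riemannSum-sub f g (cell {u} v t _ _ p) = begin-equality
    (f t - g t) * (v - u) + riemannSum (λ x → f x - g x) p
      ≈⟨ +-congˡ (riemannSum-sub f g p) ⟩
    (f t - g t) * (v - u) + (riemannSum f p - riemannSum g p)
      ≈⟨ solve 5 (λ a b l s r → (a :- b) :* l :+ (s :- r) := (a :* l :+ s) :- (b :* l :+ r)) refl
           (f t) (g t) (v - u) (riemannSum f p) (riemannSum g p) ⟩
    (f t * (v - u) + riemannSum f p) - (g t * (v - u) + riemannSum g p) ∎

  riemannSum-weighted : ∀ {N} (κ : Fin N → ℝ) (φ : Fin N → ℝ → ℝ) {u w} (p : TaggedPartition w u) →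
    riemannSum (λ x → sum λ n → κ n * φ n x) p ≈ sum λ n → κ n * riemannSum (φ n) p
  riemannSum-weighted {zero} κ φ (end _) = refl
  riemannSum-weighted {zero} κ φ (cell {u} v t _ _ p) =
    trans (+-cong (zeroˡ (v - u)) (riemannSum-weighted κ φ p)) (+-identityˡ 0#)
  riemannSum-weighted {suc N} κ φ p = trans (split p)
    (+-congˡ (riemannSum-weighted (λ n → κ (suc n)) (λ n → φ (suc n)) p))
    where
    rest : ℝ → ℝ
    rest x = sum λ n → κ (suc n) * φ (suc n) x
    split : ∀ {u w} (p : TaggedPartition w u) →
      riemannSum (λ x → κ zero * φ zero x + rest x) p ≈
      κ zero * riemannSum (φ zero) p + riemannSum rest p
    split (end _) = sym (trans (+-identityʳ _) (zeroʳ _))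
    split (cell {u} v t _ _ p) = trans (+-congˡ (split p))
      (solve 6 (λ k a r l s q → (k :* a :+ r) :* l :+ (k :* s :+ q) :=
           k :* (a :* l :+ s) :+ (r :* l :+ q))
        refl (κ zero) (φ zero t) (rest t) (v - u) (riemannSum (φ zero) p) (riemannSum rest p))

  -- Riemann integrability with a linear modulus.
  Approximates : (ℝ → ℝ) → (u w I C : ℝ) → Set
  Approximates f u w I C = ∀ {δ} → 0# < δ → (p : TaggedPartition w u) → MeshBelow δ p →
    riemannSum f p - I ≤ C * δ × I - riemannSum f p ≤ C * δ

  approximates-resp : ∀ {f g u w I J C} → (∀ x → u ≤ x → x ≤ w → f x ≈ g x) → I ≈ J →
    Approximates f u w I C → Approximates g u w J C
  approximates-resp f≈g I≈J approx 0<δ p mesh with approx 0<δ p mesh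
  ... | above , below =
    ≤.trans (≤.reflexive (+-cong (sym eq) (-‿cong (sym I≈J)))) above ,
    ≤.trans (≤.reflexive (+-cong (sym I≈J) (-‿cong (sym eq)))) below
    where eq = riemannSum-cong p f≈g

  approximates-sub : ∀ {f g u w I J C D} → Approximates f u w I C → Approximates g u w J D →
    Approximates (λ x → f x - g x) u w (I - J) (C + D)
  approximates-sub {f} {g} {I = I} {J} {C} {D} F G {δ} 0<δ p mesh with F 0<δ p mesh | G 0<δ p mesh
  ... | F⁺ , F⁻ | G⁺ , G⁻ =
    (begin
      riemannSum (λ x → f x - g x) p - (I - J)  ≈⟨ +-congʳ (riemannSum-sub f g p) ⟩
      (r - s) - (I - J)
        ≈⟨ solve 4 (λ r s i j → (r :- s) :- (i :- j) := (r :- i) :+ (j :- s)) refl r s I J ⟩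
      (r - I) + (J - s)  ≤⟨ +-mono-≤ F⁺ G⁻ ⟩
      C * δ + D * δ      ≈⟨ distribʳ δ C D ⟨
      (C + D) * δ        ∎) ,
    (begin
      (I - J) - riemannSum (λ x → f x - g x) p  ≈⟨ +-congˡ (-‿cong (riemannSum-sub f g p)) ⟩
      (I - J) - (r - s)
        ≈⟨ solve 4 (λ r s i j → (i :- j) :- (r :- s) := (i :- r) :+ (s :- j)) refl r s I J ⟩
      (I - r) + (s - J)  ≤⟨ +-mono-≤ F⁻ G⁺ ⟩
      C * δ + D * δ      ≈⟨ distribʳ δ C D ⟨
      (C + D) * δ        ∎)
    where
    r = riemannSum f p
    s = riemannSum g p

  weighted-gap : ∀ {N} {κ r s C : Fin N → ℝ} {δ} → (∀ n → 0# ≤ κ n) → (∀ n → r n - s n ≤ C n * δ) →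
    sum (λ n → κ n * r n) - sum (λ n → κ n * s n) ≤ sum (λ n → κ n * C n) * δ
  weighted-gap {zero} {δ = δ} 0≤κ r-s≤Cδ = ≤.reflexive (trans (-‿inverseʳ 0#) (sym (zeroˡ δ)))
  weighted-gap {suc N} {κ} {r} {s} {C} {δ} 0≤κ r-s≤Cδ = begin
    (k * r₀ + R) - (k * s₀ + S)
      ≈⟨ solve 5 (λ k r s R S → (k :* r :+ R) :- (k :* s :+ S) :=
           k :* (r :- s) :+ (R :- S)) refl k r₀ s₀ R S ⟩
    k * (r₀ - s₀) + (R - S)
      ≤⟨ +-mono-≤ (*-monoˡ-≤ (0≤κ zero) (r-s≤Cδ zero)) (weighted-gap (λ n → 0≤κ (suc n)) (λ n → r-s≤Cδ (suc n))) ⟩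
    k * (C zero * δ) + D * δ
      ≈⟨ solve 4 (λ k c D d → k :* (c :* d) :+ D :* d := (k :* c :+ D) :* d) refl k (C zero) D δ ⟩
    (k * C zero + D) * δ             ∎
    where
    k = κ zero
    r₀ = r zero
    s₀ = s zero
    R = sum λ n → κ (suc n) * r (suc n)
    S = sum λ n → κ (suc n) * s (suc n)
    D = sum λ n → κ (suc n) * C (suc n)

  approximates-weighted : ∀ {N} {κ I C : Fin N → ℝ} {φ : Fin N → ℝ → ℝ} {u w} → (∀ n → 0# ≤ κ n) →
    (∀ n → Approximates (φ n) u w (I n) (C n)) →
    Approximates (λ x → sum λ n → κ n * φ n x) u w (sum λ n → κ n * I n) (sum λ n → κ n * C n)
  approximates-weighted {κ = κ} {φ = φ} 0≤κ Φ 0<δ p mesh =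
    ≤.trans (≤.reflexive (+-congʳ eq)) (weighted-gap 0≤κ λ n → proj₁ (Φ n 0<δ p mesh)) ,
    ≤.trans (≤.reflexive (+-congˡ (-‿cong eq))) (weighted-gap 0≤κ λ n → proj₂ (Φ n 0<δ p mesh))
    where eq = riemannSum-weighted κ φ p

  -- The hypothesis supplies `I` with an unknown modulus, the computation supplies `J` with a linear
  -- one; on a partition fine enough for both, the same Riemann sum is close to each.
  integral-unique : ∀ {f u w I J C} → u ≤ w → 0# ≤ C →
    HasIntegral f u w I → Approximates f u w J C → I ≈ J
  integral-unique {f} {u} {w} {I} {J} {C} u≤w 0≤C integral approx =
    ≈-from-both (+-nonNeg 0≤1 0≤C) close
    where
    close : ∀ ε → 0# < ε → I - J ≤ (1# + C) * ε × J - I ≤ (1# + C) * ε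
    close ε 0<ε with integral ε 0<ε
    ... | δ , 0<δ , small = gap I-r<ε r-J≤Cη , gap′ J-r≤Cη r-I<ε
      where
      -- Mesh below `δ` serves `integral`; mesh below `ε` keeps the error `C * η` within `C * ε`.
      η = δ ⊓ ε
      0<η : 0# < η
      0<η with ⊓-sel δ ε
      ... | inj₁ η≈δ = <-≤-trans 0<δ (≤.reflexive (sym η≈δ))
      ... | inj₂ η≈ε = <-≤-trans 0<ε (≤.reflexive (sym η≈ε))
      fine = partition-exists 0<η u≤w
      p = proj₁ fine
      r = riemannSum f p
      within = small p (meshBelow-mono (x⊓y≤x δ ε) p (proj₂ fine))
      r-I<ε = proj₁ (proj₁ within)
      I-r<ε = proj₁ (proj₂ within)
      scale : ∀ {x} → x ≤ C * η → x ≤ C * ε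
      scale h = ≤.trans h (*-monoˡ-≤ 0≤C (x⊓y≤y δ ε))
      r-J≤Cη = scale (proj₁ (approx 0<η p (proj₂ fine)))
      J-r≤Cη = scale (proj₂ (approx 0<η p (proj₂ fine)))
      gap : I - r ≤ ε → r - J ≤ C * ε → I - J ≤ (1# + C) * ε
      gap h₁ h₂ = ≤-from-gap (+-nonNeg (0≤y-x h₁) (0≤y-x h₂))
        (solve 5 (λ i j r c e → (con (+ 1) :+ c) :* e :- (i :- j) :=
             (e :- (i :- r)) :+ (c :* e :- (r :- j))) refl I J r C ε)
      gap′ : J - r ≤ C * ε → r - I ≤ ε → J - I ≤ (1# + C) * ε
      gap′ h₁ h₂ = ≤-from-gap (+-nonNeg (0≤y-x h₁) (0≤y-x h₂))
        (solve 5 (λ i j r c e → (con (+ 1) :+ c) :* e :- (j :- i) :=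
             (c :* e :- (j :- r)) :+ (e :- (r :- i))) refl I J r C ε)

  -- Integrals of indicators and of step densities

  step : ℝ → ℝ → ℝ
  step a x = indicator (a ≤? x)

  -- Moving the threshold a by δ absorbs the one cell that contains it.
  step-cell-upper : ∀ {a u t v δ} → u ≤ t → t ≤ v → v - u ≤ δ →
    step a t * (v - u) ≤ (v ⊔ (a - δ)) - (u ⊔ (a - δ))
  step-cell-upper {a} {u} {t} {v} {δ} u≤t t≤v v-u≤δ with a ≤? t
  ... | yes a≤t = begin
    1# * (v - u)                     ≈⟨ *-identityˡ (v - u) ⟩
    v - u                            ≈⟨ +-cong (x≤y⇒y⊔x≈y (≤.trans a-δ≤u (≤.trans u≤t t≤v)))
                                               (-‿cong (x≤y⇒y⊔x≈y a-δ≤u)) ⟨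
    (v ⊔ (a - δ)) - (u ⊔ (a - δ))    ∎
    where
    a-δ≤u : a - δ ≤ u
    a-δ≤u = ≤-from-gap (+-nonNeg (0≤y-x v-u≤δ) (0≤y-x (≤.trans a≤t t≤v)))
      (solve 4 (λ a u v δ → u :- (a :- δ) := (δ :- (v :- u)) :+ (v :- a)) refl a u v δ)
  ... | no _ = begin
    0# * (v - u)                     ≈⟨ zeroˡ (v - u) ⟩
    0#                               ≤⟨ 0≤y-x (⊔-monoˡ-≤ (a - δ) (≤.trans u≤t t≤v)) ⟩
    (v ⊔ (a - δ)) - (u ⊔ (a - δ))    ∎

  ⊔-nonexpansive : ∀ a {u v} → u ≤ v → (v ⊔ a) - (u ⊔ a) ≤ v - u
  ⊔-nonexpansive a {u} {v} u≤v with ⊔-sel v a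
  ... | inj₁ v⊔a≈v = -‿mono-≤ (≤.reflexive v⊔a≈v) (x≤x⊔y u a)
  ... | inj₂ v⊔a≈a = begin
    (v ⊔ a) - (u ⊔ a)    ≤⟨ -‿mono-≤ (≤.reflexive v⊔a≈a) (x≤y⊔x u a) ⟩
    a - a                ≈⟨ -‿inverseʳ a ⟩
    0#                   ≤⟨ 0≤y-x u≤v ⟩
    v - u                ∎

  step-cell-lower : ∀ {a u t v δ} → u ≤ t → t ≤ v → v - u ≤ δ →
    (v ⊔ (a + δ)) - (u ⊔ (a + δ)) ≤ step a t * (v - u)
  step-cell-lower {a} {u} {t} {v} {δ} u≤t t≤v v-u≤δ with a ≤? t
  ... | yes _ = ≤.trans (⊔-nonexpansive (a + δ) (≤.trans u≤t t≤v)) (≤.reflexive (sym (*-identityˡ (v - u))))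
  ... | no a≰t = ≤.reflexive (begin-equality
    (v ⊔ (a + δ)) - (u ⊔ (a + δ))
      ≈⟨ +-cong (x≤y⇒x⊔y≈y v≤a+δ) (-‿cong (x≤y⇒x⊔y≈y (≤.trans (≤.trans u≤t t≤v) v≤a+δ))) ⟩
    (a + δ) - (a + δ)                ≈⟨ -‿inverseʳ (a + δ) ⟩
    0#                               ≈⟨ zeroˡ (v - u) ⟨
    0# * (v - u)                     ∎)
    where
    u≤a : u ≤ a
    u≤a = ≤.trans u≤t (proj₁ (≰⇒> a≰t))
    v≤a+δ : v ≤ a + δ
    v≤a+δ = ≤-from-gap (+-nonNeg (0≤y-x u≤a) (0≤y-x v-u≤δ))
      (solve 4 (λ a u v δ → (a :+ δ) :- v := (a :- u) :+ (δ :- (v :- u))) refl a u v δ)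

  step-sum-upper : ∀ {a δ u w} (p : TaggedPartition w u) → MeshBelow δ p →
    riemannSum (step a) p ≤ (w ⊔ (a - δ)) - (u ⊔ (a - δ))
  step-sum-upper {a} {δ} (end u≈w) _ = 0≤y-x (⊔-monoˡ-≤ (a - δ) (≤.reflexive u≈w))
  step-sum-upper {a} {δ} {u} {w} (cell v t u≤t t≤v p) ((v-u≤δ , _) , mesh) = ≤.trans
    (+-mono-≤ (step-cell-upper u≤t t≤v v-u≤δ) (step-sum-upper p mesh))
    (≤.reflexive (solve 3 (λ u v w → (v :- u) :+ (w :- v) := w :- u) refl
      (u ⊔ (a - δ)) (v ⊔ (a - δ)) (w ⊔ (a - δ))))

  step-sum-lower : ∀ {a δ u w} (p : TaggedPartition w u) → MeshBelow δ p →
    (w ⊔ (a + δ)) - (u ⊔ (a + δ)) ≤ riemannSum (step a) p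
  step-sum-lower {a} {δ} {u} {w} (end u≈w) _ = ≤.reflexive
    (trans (+-congʳ (⊔-congʳ (a + δ) (sym u≈w))) (-‿inverseʳ _))
  step-sum-lower {a} {δ} {u} {w} (cell v t u≤t t≤v p) ((v-u≤δ , _) , mesh) = ≤.trans
    (≤.reflexive (solve 3 (λ u v w → w :- u := (v :- u) :+ (w :- v)) refl
      (u ⊔ (a + δ)) (v ⊔ (a + δ)) (w ⊔ (a + δ))))
    (+-mono-≤ (step-cell-lower u≤t t≤v v-u≤δ) (step-sum-lower p mesh))

  ⊔-shift : ∀ x a {δ} → 0# ≤ δ → x ⊔ (a + δ) ≤ (x ⊔ a) + δ
  ⊔-shift x a {δ} 0≤δ = ⊔-lub (≤.trans (x≤x⊔y x a) (x≤x+y 0≤δ))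
    (+-mono-≤ (x≤y⊔x x a) ≤.refl)

  -- Replacing `a` by `a - δ` or `a + δ` moves the ramp `x ⊔ a` by at most `δ`. At one endpoint the
  -- shift has the favourable sign, so only the other one costs `δ`, hence the constant `1#`.
  step-approximates : ∀ a u w → Approximates (step a) u w ((w ⊔ a) - (u ⊔ a)) 1#
  step-approximates a u w {δ} (0≤δ , _) p mesh =
    ≤-from-gap (+-nonNeg (0≤y-x (step-sum-upper p mesh))
      (+-nonNeg (0≤y-x (⊔-monoʳ-≤ w (x-y≤x 0≤δ))) (0≤y-x u⊔a≤)))
      (solve 6 (λ δ r w′ u′ w₀ u₀ → con (+ 1) :* δ :- (r :- (w₀ :- u₀)) :=
        ((w′ :- u′) :- r) :+ ((w₀ :- w′) :+ ((u′ :+ δ) :- u₀))) refl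
        δ (riemannSum (step a) p) (w ⊔ (a - δ)) (u ⊔ (a - δ)) (w ⊔ a) (u ⊔ a)) ,
    ≤-from-gap (+-nonNeg (0≤y-x (step-sum-lower p mesh))
      (+-nonNeg (0≤y-x (⊔-monoʳ-≤ w (x≤x+y 0≤δ))) (0≤y-x (⊔-shift u a 0≤δ))))
      (solve 6 (λ δ r w′ u′ w₀ u₀ → con (+ 1) :* δ :- ((w₀ :- u₀) :- r) :=
        (r :- (w′ :- u′)) :+ ((w′ :- w₀) :+ ((u₀ :+ δ) :- u′))) refl
        δ (riemannSum (step a) p) (w ⊔ (a + δ)) (u ⊔ (a + δ)) (w ⊔ a) (u ⊔ a))
    where
    u⊔a≤ : u ⊔ a ≤ (u ⊔ (a - δ)) + δ
    u⊔a≤ = ≤.trans (≤.reflexive (⊔-congˡ u (solve 2 (λ a δ → a := (a :- δ) :+ δ) refl a δ)))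
      (⊔-shift u (a - δ) 0≤δ)

  -- The nearest point to `x` in `[a, b]`. As a function of `x` it is an antiderivative of the
  -- indicator of `[a, b)`, hence its presence in every distribution function below.
  clip : (a b x : ℝ) → ℝ
  clip a b x = a ⊔ (x ⊓ b)

  module _ {a b : ℝ} (a≤b : a ≤ b) where
    clip-below : ∀ {x} → x ≤ a → clip a b x ≈ a
    clip-below x≤a = x≤y⇒y⊔x≈y (x≤y⇒x⊓z≤y b x≤a)

    clip-above : ∀ {x} → b ≤ x → clip a b x ≈ b
    clip-above b≤x = trans (⊔-congˡ a (x≤y⇒y⊓x≈x b≤x)) (x≤y⇒x⊔y≈y a≤b)

    clip-inside : ∀ {x} → a ≤ x → x ≤ b → clip a b x ≈ x
    clip-inside a≤x x≤b = trans (⊔-congˡ a (x≤y⇒x⊓y≈x x≤b)) (x≤y⇒x⊔y≈y a≤x)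

    clip-mono : ∀ {x y} → x ≤ y → clip a b x ≤ clip a b y
    clip-mono x≤y = ⊔-monoʳ-≤ a (⊓-monoˡ-≤ b x≤y)

    clip≤b : ∀ x → clip a b x ≤ b
    clip≤b x = ⊔-lub a≤b (x⊓y≤y x b)

    -- Integrating two steps yields a difference of ramps. In the form of a clip its monotonicity
    -- and its piecewise coincidence with the identity become visible.
    clip≈ramps : ∀ x → clip a b x ≈ b + ((x ⊔ a) - (x ⊔ b))
    clip≈ramps x = by-position (≤.total x a) (≤.total b x)
      where
      by-position : x ≤ a ⊎ a ≤ x → b ≤ x ⊎ x ≤ b → clip a b x ≈ b + ((x ⊔ a) - (x ⊔ b))
      by-position (inj₁ x≤a) _ = begin-equality
        clip a b x                   ≈⟨ clip-below x≤a ⟩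
        a                            ≈⟨ solve 2 (λ a b → a := b :+ (a :- b)) refl a b ⟩
        b + (a - b)
          ≈⟨ +-congˡ (+-cong (x≤y⇒x⊔y≈y x≤a) (-‿cong (x≤y⇒x⊔y≈y (≤.trans x≤a a≤b)))) ⟨
        b + ((x ⊔ a) - (x ⊔ b))      ∎
      by-position (inj₂ a≤x) (inj₁ b≤x) = begin-equality
        clip a b x                   ≈⟨ clip-above b≤x ⟩
        b                            ≈⟨ solve 2 (λ x b → b := b :+ (x :- x)) refl x b ⟩
        b + (x - x)                  ≈⟨ +-congˡ (+-cong (x≤y⇒y⊔x≈y a≤x) (-‿cong (x≤y⇒y⊔x≈y b≤x))) ⟨
        b + ((x ⊔ a) - (x ⊔ b))      ∎
      by-position (inj₂ a≤x) (inj₂ x≤b) = begin-equality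
        clip a b x                   ≈⟨ clip-inside a≤x x≤b ⟩
        x                            ≈⟨ solve 2 (λ x b → x := b :+ (x :- b)) refl x b ⟩
        b + (x - b)                  ≈⟨ +-congˡ (+-cong (x≤y⇒y⊔x≈y a≤x) (-‿cong (x≤y⇒x⊔y≈y x≤b))) ⟨
        b + ((x ⊔ a) - (x ⊔ b))      ∎

    -- Splitting into two Heaviside functions leaves a single jump to control in each Riemann sum.
    -- Both steps include their thresholds, which matches the half-open interval.
    steps≈indicator : ∀ x → step a x - step b x ≈ indicator (a ≤? x ×-dec x <? b)
    steps≈indicator x with a ≤? x | b ≤? x
    ... | a≤?x | yes b≤x = begin-equality
      indicator a≤?x - 1#    ≈⟨ +-congʳ (if-yes a≤?x (≤.trans a≤b b≤x)) ⟩
      1# - 1#                ≈⟨ -‿inverseʳ 1# ⟩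
      0#                     ≈⟨ if-no (a≤?x ×-dec x <? b) (λ (_ , x<b) → <⇒≱ x<b b≤x) ⟨
      indicator (a≤?x ×-dec x <? b) ∎
    ... | yes a≤x | no b≰x = begin-equality
      1# - 0#                ≈⟨ solve 0 (con (+ 1) :- con (+ 0) := con (+ 1)) refl ⟩
      1#                     ≈⟨ if-yes (yes a≤x ×-dec x <? b) (a≤x , ≰⇒> b≰x) ⟨
      indicator (yes a≤x ×-dec x <? b) ∎
    ... | no a≰x | no b≰x = -‿inverseʳ 0#

    indicator-approximates : ∀ u w →
      Approximates (λ x → indicator (a ≤? x ×-dec x <? b)) u w (clip a b w - clip a b u) (1# + 1#)
    indicator-approximates u w = approximates-resp
      (λ x _ _ → steps≈indicator x)
      (begin-equality
        ((w ⊔ a) - (u ⊔ a)) - ((w ⊔ b) - (u ⊔ b))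
          ≈⟨ solve 5 (λ b w u w′ u′ → (w :- u) :- (w′ :- u′) :=
               (b :+ (w :- w′)) :- (b :+ (u :- u′))) refl
               b (w ⊔ a) (u ⊔ a) (w ⊔ b) (u ⊔ b) ⟩
        (b + ((w ⊔ a) - (w ⊔ b))) - (b + ((u ⊔ a) - (u ⊔ b)))
          ≈⟨ +-cong (clip≈ramps w) (-‿cong (clip≈ramps u)) ⟨
        clip a b w - clip a b u ∎)
      (approximates-sub (step-approximates a u w) (step-approximates b u w))

  indicator-nonNeg : ∀ {P : Set} (P? : Dec P) → 0# ≤ indicator P?
  indicator-nonNeg (yes _) = 0≤1
  indicator-nonNeg (no _)  = ≤.refl

  -- The iterated integral comes with some inner integral `g`. Uniqueness in `y` pins down `g x` for
  -- each `x` in `[u, v]`, and uniqueness in `x` then pins down `I`. Both times the remaining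
  -- factors act as nonnegative weights of the indicators.
  rectangles-integral : ∀ {N} {k a b c d : Fin N → ℝ} →
    (∀ n → 0# ≤ k n) → (∀ n → a n ≤ b n) → (∀ n → c n ≤ d n) →
    ∀ {u v s t I} → u ≤ v → s ≤ t →
    HasIteratedIntegral (λ x y → sum λ n →
      k n * indicator (a n ≤? x ×-dec x <? b n) * indicator (c n ≤? y ×-dec y <? d n)) u v s t I →
    I ≈ sum λ n → k n * (clip (c n) (d n) t - clip (c n) (d n) s) * (clip (a n) (b n) v - clip (a n) (b n) u)
  rectangles-integral {N} {k} {a} {b} {c} {d} 0≤k a≤b c≤d {u} {v} {s} {t} u≤v s≤t (g , inner , outer) =
    integral-unique u≤v
      (sum-nonNeg λ n → *-nonNeg (0≤kL n) 0≤2)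
      outer
      (approximates-resp
        (λ x u≤x x≤v → sym (trans (g≈ x u≤x x≤v) (sum-cong λ n →
          solve 3 (λ k i l → k :* i :* l := k :* l :* i) refl (k n) (X n x) (L n))))
        refl
        (approximates-weighted 0≤kL λ n → indicator-approximates (a≤b n) u v))
    where
    X Y : Fin N → ℝ → ℝ
    X n x = indicator (a n ≤? x ×-dec x <? b n)
    Y n y = indicator (c n ≤? y ×-dec y <? d n)
    L : Fin N → ℝ
    L n = clip (c n) (d n) t - clip (c n) (d n) s
    0≤2 : 0# ≤ 1# + 1#
    0≤2 = +-nonNeg 0≤1 0≤1
    0≤kL : ∀ n → 0# ≤ k n * L n
    0≤kL n = *-nonNeg (0≤k n) (0≤y-x (clip-mono (c≤d n) s≤t))
    0≤kX : ∀ x n → 0# ≤ k n * X n x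
    0≤kX x n = *-nonNeg (0≤k n) (indicator-nonNeg (a n ≤? x ×-dec x <? b n))
    g≈ : ∀ x → u ≤ x → x ≤ v → g x ≈ sum λ n → k n * X n x * L n
    g≈ x u≤x x≤v = integral-unique s≤t
      (sum-nonNeg λ n → *-nonNeg (0≤kX x n) 0≤2)
      (inner x u≤x x≤v)
      (approximates-weighted (0≤kX x) λ n → indicator-approximates (c≤d n) s t)

-- Finite additivity and null events

module Events (em : ExcludedMiddle 0ℓ) {ℛ : CompleteOrderedField} {o ℓ} (𝒫 : ProbabilitySpace ℛ o ℓ) where
  open CompleteOrderedField ℛ hiding (zero)
  open ProbabilitySpace 𝒫
  open IntegerSolver commutativeRing
  open OrderedField ℛ
  open RiemannSums em ℛ
  open import Relation.Binary.Reasoning.PartialOrder (DecTotalOrder.poset decTotalOrder)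

  private
    variable
      A B C : Pred Ω 0ℓ

  -- The axioms concern countable unions only; this sequence specialises them to two events.
  thenEmpty : Pred Ω 0ℓ → Pred Ω 0ℓ → ℕ → Pred Ω 0ℓ
  thenEmpty A B 0             = A
  thenEmpty A B 1             = B
  thenEmpty A B (suc (suc _)) = ∅

  ⋃-thenEmpty : ⋃ ℕ (thenEmpty A B) ≐ A ∪ B
  ⋃-thenEmpty = (λ { (0 , a) → inj₁ a ; (1 , b) → inj₂ b ; (suc (suc _) , ()) }) ,
                (λ { (inj₁ a) → 0 , a ; (inj₂ b) → 1 , b })

  measurable-∅ : Measurable ∅
  measurable-∅ = measurable-≐ ((λ f → f tt) , λ ()) (measurable-∁ measurable-U)

  measurable-thenEmpty : Measurable A → Measurable B → ∀ n → Measurable (thenEmpty A B n)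
  measurable-thenEmpty mA mB 0             = mA
  measurable-thenEmpty mA mB 1             = mB
  measurable-thenEmpty mA mB (suc (suc _)) = measurable-∅

  measurable-∪ : Measurable A → Measurable B → Measurable (A ∪ B)
  measurable-∪ mA mB = measurable-≐ ⋃-thenEmpty (measurable-⋃ (measurable-thenEmpty mA mB))

  measurable-∩ : Measurable A → Measurable B → Measurable (A ∩ B)
  measurable-∩ mA mB = measurable-≐
    ((λ f → decidable-stable em (f ∘ inj₁) , decidable-stable em (f ∘ inj₂)) ,
     (λ { (a , b) (inj₁ ¬a) → ¬a a ; (a , b) (inj₂ ¬b) → ¬b b }))
    (measurable-∁ (measurable-∪ (measurable-∁ mA) (measurable-∁ mB)))

  -- Countable additivity for the constant sequence `∅`: two consecutive partial sums differ by
  -- `ℙ ∅`, and both lie within `ε` of the limit.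
  ℙ-∅ : ℙ ∅ ≈ 0#
  ℙ-∅ = ≤.antisym (≤-vanishing (+-nonNeg 0≤1 0≤1) small) (ℙ-nonNeg measurable-∅)
    where
    p = ℙ ∅
    l = ℙ (⋃ ℕ λ _ → ∅)
    small : ∀ ε → 0# < ε → p ≤ (1# + 1#) * ε
    small ε 0<ε with ℙ-⋃ {A = λ _ → ∅} (λ _ → measurable-∅) (λ _ ()) ε 0<ε
    ... | m , close with close m ℕ.≤-refl | close (suc m) (ℕ.n≤1+n m)
    ...   | _ , (l-S≤ε , _) | (p+S-l≤ε , _) , _ = ≤-from-gap (+-nonNeg (0≤y-x l-S≤ε) (0≤y-x p+S-l≤ε))
      (solve 4 (λ p s l e → (con (+ 1) :+ con (+ 1)) :* e :- p :=
           (e :- (l :- s)) :+ (e :- (p :+ s :- l))) refl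
        p (sum {m} λ _ → p) l ε)

  ℙ-∪ : Measurable A → Measurable B → (∀ {ω} → A ω → ¬ B ω) → ℙ (A ∪ B) ≈ ℙ A + ℙ B
  ℙ-∪ {A} {B} mA mB A⊥B = trans (sym (ℙ-cong (measurable-⋃ measurable) ⋃-thenEmpty))
    (≈-from-both 0≤1 close)
    where
    measurable = measurable-thenEmpty mA mB
    disjoint : ∀ {m n} → m ≢ n → ∀ {ω} → thenEmpty A B m ω → ¬ thenEmpty A B n ω
    disjoint {0} {0} m≢n a a′ = m≢n ≡.refl
    disjoint {0} {1} m≢n a b = A⊥B a b
    disjoint {1} {0} m≢n b a = A⊥B a b
    disjoint {1} {1} m≢n b b′ = m≢n ≡.refl
    disjoint {0} {suc (suc _)} m≢n _ ()
    disjoint {1} {suc (suc _)} m≢n _ ()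
    disjoint {suc (suc _)} m≢n ()
    l = ℙ (⋃ ℕ (thenEmpty A B))
    close : ∀ ε → 0# < ε → l - (ℙ A + ℙ B) ≤ 1# * ε × (ℙ A + ℙ B) - l ≤ 1# * ε
    close ε 0<ε with ℙ-⋃ measurable disjoint ε 0<ε
    -- The index `m + 2` ensures that the partial sum contains both events; its other terms are
    -- `ℙ ∅`.
    ... | m , within with within (suc (suc m)) (ℕ.m≤n+m m 2)
    ...   | (S-l≤ε , _) , (l-S≤ε , _) =
      ≤.trans (≤.reflexive (+-congˡ (-‿cong (sym S≈)))) (≤.trans l-S≤ε ε≤1ε) ,
      ≤.trans (≤.reflexive (+-congʳ (sym S≈))) (≤.trans S-l≤ε ε≤1ε)
      where
      ε≤1ε = ≤.reflexive (sym (*-identityˡ ε))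
      S≈ : ℙ A + (ℙ B + sum {m} (λ _ → ℙ ∅)) ≈ ℙ A + ℙ B
      S≈ = +-congˡ (trans (+-congˡ (sum-zero {m} λ _ → ℙ-∅)) (+-identityʳ (ℙ B)))

  ℙ-split : Measurable A → Measurable B → ℙ A ≈ ℙ (A ∩ B) + ℙ (A ∩ ∁ B)
  ℙ-split {A} {B} mA mB = trans (ℙ-cong mA (to , from))
    (ℙ-∪ (measurable-∩ mA mB) (measurable-∩ mA (measurable-∁ mB)) λ (_ , b) (_ , ¬b) → ¬b b)
    where
    to : A ⊆ (A ∩ B) ∪ (A ∩ ∁ B)
    to {ω} a with em {P = B ω}
    ... | yes b = inj₁ (a , b)
    ... | no ¬b = inj₂ (a , ¬b)
    from : (A ∩ B) ∪ (A ∩ ∁ B) ⊆ A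
    from (inj₁ (a , _)) = a
    from (inj₂ (a , _)) = a

  ℙ-∖ : Measurable A → Measurable B → A ⊆ B → ℙ (B ∩ ∁ A) ≈ ℙ B - ℙ A
  ℙ-∖ {A} {B} mA mB A⊆B = begin-equality
    ℙ (B ∩ ∁ A)
      ≈⟨ solve 2 (λ x y → y := (x :+ y) :- x) refl (ℙ (B ∩ A)) (ℙ (B ∩ ∁ A)) ⟩
    (ℙ (B ∩ A) + ℙ (B ∩ ∁ A)) - ℙ (B ∩ A)   ≈⟨ +-cong (sym (ℙ-split mB mA))
                                                  (-‿cong (ℙ-cong (measurable-∩ mB mA) (proj₂ , λ a → A⊆B a , a))) ⟩
    ℙ B - ℙ A                               ∎

  ℙ-mono : Measurable A → Measurable B → A ⊆ B → ℙ A ≤ ℙ B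
  ℙ-mono mA mB A⊆B = ≤-from-gap (ℙ-nonNeg (measurable-∩ mB (measurable-∁ mA))) (sym (ℙ-∖ mA mB A⊆B))

  ℙ-empty : Measurable A → (∀ {ω} → ¬ A ω) → ℙ A ≈ 0#
  ℙ-empty mA ¬A = trans (ℙ-cong mA (¬A , λ ())) ℙ-∅

  -- Confines events to a bounded region of full probability, where the density or the function `H`
  -- can be applied.
  ℙ-∩-almostSure : Measurable A → Measurable B → ℙ B ≈ 1# → ℙ A ≈ ℙ (A ∩ B)
  ℙ-∩-almostSure {A} {B} mA mB ℙB≈1 = begin-equality
    ℙ A                         ≈⟨ ℙ-split mA mB ⟩
    ℙ (A ∩ B) + ℙ (A ∩ ∁ B)     ≈⟨ +-congˡ null ⟩
    ℙ (A ∩ B) + 0#              ≈⟨ +-identityʳ _ ⟩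
    ℙ (A ∩ B)                   ∎
    where
    m∁B = measurable-∁ mB
    mA∩∁B = measurable-∩ mA m∁B
    null : ℙ (A ∩ ∁ B) ≈ 0#
    null = ≤.antisym
      (begin
        ℙ (A ∩ ∁ B)   ≤⟨ ℙ-mono mA∩∁B (measurable-∩ measurable-U m∁B) (λ (_ , ¬b) → tt , ¬b) ⟩
        ℙ (U ∩ ∁ B)   ≈⟨ ℙ-∖ mB measurable-U (λ _ → tt) ⟩
        ℙ U - ℙ B     ≈⟨ +-cong ℙ-U (-‿cong ℙB≈1) ⟩
        1# - 1#       ≈⟨ -‿inverseʳ 1# ⟩
        0#            ∎)
      (ℙ-nonNeg mA∩∁B)

  -- The pieces are asked to cover `A` rather than `Ω`, so that after splitting off the first piece
  -- the induction can continue with the rest of `A`.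
  ℙ-pieces : ∀ {n} {piece : Fin n → Pred Ω 0ℓ} → (∀ i → Measurable (piece i)) →
    (∀ {i j ω} → piece i ω → piece j ω → i ≡ j) →
    Measurable A → (∀ {ω} → A ω → ∃[ i ] piece i ω) →
    sum (λ i → ℙ (piece i ∩ A)) ≈ ℙ A
  ℙ-pieces {n = zero} _ _ mA covered = sym (ℙ-empty mA λ a → ¬Fin0 (proj₁ (covered a)))
  ℙ-pieces {A} {n = suc n} {piece} measurable disjoint mA covered = begin-equality
    ℙ (P₀ ∩ A) + sum (λ i → ℙ (piece (suc i) ∩ A))
      ≈⟨ +-cong (ℙ-cong (measurable-∩ (measurable zero) mA) ((λ (p , a) → a , p) , λ (a , p) → p , a))
                (sum-cong λ i → ℙ-cong (measurable-∩ (measurable (suc i)) mA)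
                  ((λ (p , a) → p , a , λ p₀ → 0≢suc (disjoint p₀ p)) , λ (p , a , _) → p , a)) ⟩
    ℙ (A ∩ P₀) + sum (λ i → ℙ (piece (suc i) ∩ (A ∩ ∁ P₀)))
      ≈⟨ +-congˡ (ℙ-pieces (measurable ∘ suc) (λ p q → suc-injective (disjoint p q))
                   (measurable-∩ mA (measurable-∁ (measurable zero))) λ (a , ¬p₀) → later ¬p₀ (covered a)) ⟩
    ℙ (A ∩ P₀) + ℙ (A ∩ ∁ P₀)
      ≈⟨ ℙ-split mA (measurable zero) ⟨
    ℙ A ∎
    where
    P₀ = piece zero
    0≢suc : ∀ {i : Fin n} → zero ≢ suc i
    0≢suc ()
    later : ∀ {ω} → ¬ P₀ ω → ∃[ i ] piece i ω → ∃[ i ] piece (suc i) ω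
    later ¬p₀ (zero  , p) = ⊥-elim (¬p₀ p)
    later ¬p₀ (suc i , p) = i , p

-- The mean of a nonnegative variable from its distribution function

module Expectation (em : ExcludedMiddle 0ℓ) {ℛ : CompleteOrderedField} {o ℓ} (𝒫 : ProbabilitySpace ℛ o ℓ) where
  open CompleteOrderedField ℛ hiding (zero)
  open RiemannIntegral ℛ
  open ProbabilitySpace 𝒫
  open Probability 𝒫
  open SimpleFunction
  open IntegerSolver commutativeRing
  open OrderedField ℛ
  open RiemannSums em ℛ
  open Events em 𝒫
  open import Relation.Binary.Reasoning.PartialOrder (DecTotalOrder.poset decTotalOrder)

  -- H is a Stieltjes integral ∫ x dF.
  Brackets : (F H : ℝ → ℝ) → Set
  Brackets F H = ∀ {s t} → 0# ≤ s → s ≤ t →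
    s * (F t - F s) ≤ H t - H s × H t - H s ≤ t * (F t - F s)

  -- On a cell `t - s` is at most `δ`, so each increment of `G` is at most `δ` times that of `F`,
  -- and the increments of `F` add up. As the mesh vanishes, `G` cannot have grown.
  telescope : ∀ {F G : ℝ → ℝ} {u₀} →
    (∀ {s t} → u₀ ≤ s → s ≤ t → F s ≤ F t × G t - G s ≤ (t - s) * (F t - F s)) →
    ∀ {δ u w} → u₀ ≤ u → 0# ≤ δ → (p : TaggedPartition w u) → MeshBelow δ p →
    G w - G u ≤ δ * (F w - F u)
  -- `G` is an arbitrary function and may not respect `≈`, so even the degenerate interval goes
  -- through `increment`.
  telescope {F} {G} increment {δ} {u} {w} u₀≤u 0≤δ (end u≈w) _ =
    ≤.trans (proj₂ (increment u₀≤u u≤w))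
      (*-monoʳ-≤ (0≤y-x (proj₁ (increment u₀≤u u≤w)))
        (≤.trans (≤.reflexive (trans (+-congʳ (sym u≈w)) (-‿inverseʳ u))) 0≤δ))
    where u≤w = ≤.reflexive u≈w
  telescope {F} {G} increment {δ} {u} {w} u₀≤u 0≤δ (cell v t u≤t t≤v p) ((v-u≤δ , _) , mesh) = begin
    G w - G u
      ≈⟨ solve 3 (λ u v w → w :- u := (v :- u) :+ (w :- v)) refl (G u) (G v) (G w) ⟩
    (G v - G u) + (G w - G v)            ≤⟨ +-mono-≤
      (≤.trans (proj₂ (increment u₀≤u u≤v)) (*-monoʳ-≤ (0≤y-x (proj₁ (increment u₀≤u u≤v))) v-u≤δ))
      (telescope increment (≤.trans u₀≤u u≤v) 0≤δ p mesh) ⟩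
    δ * (F v - F u) + δ * (F w - F v)
      ≈⟨ solve 4 (λ d u v w → d :* (v :- u) :+ d :* (w :- v) := d :* (w :- u)) refl δ (F u) (F v) (F w) ⟩
    δ * (F w - F u)                      ∎
    where u≤v = ≤.trans u≤t t≤v

  prepend : {A : Pred Ω 0ℓ} → Measurable A → ∀ {s} → 0# ≤ s → SimpleFunction → SimpleFunction
  prepend {A} mA {s} 0≤s φ = record
    { size       = suc (size φ)
    ; piece      = pieces
    ; measurable = λ { zero → mA ; (suc i) → measurable-∩ (measurable-∁ mA) (measurable φ i) }
    ; covering   = cover
    ; disjoint   = λ {i} {j} → disj i j
    ; value      = λ { zero → s ; (suc i) → value φ i }
    ; nonNeg     = λ { zero → 0≤s ; (suc i) → nonNeg φ i }
    }
    where
    pieces : Fin (suc (size φ)) → Pred Ω 0ℓ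
    pieces zero    = A
    pieces (suc i) = ∁ A ∩ piece φ i
    cover : ∀ ω → ∃[ i ] pieces i ω
    cover ω with em {P = A ω}
    ... | yes a = zero , a
    ... | no ¬a = suc (proj₁ (covering φ ω)) , ¬a , proj₂ (covering φ ω)
    disj : ∀ i j {ω} → pieces i ω → pieces j ω → i ≡ j
    disj zero    zero    _        _        = ≡.refl
    disj zero    (suc _) a        (¬a , _) = ⊥-elim (¬a a)
    disj (suc _) zero    (¬a , _) a        = ⊥-elim (¬a a)
    disj (suc i) (suc j) (_ , p)  (_ , q)  = ≡.cong suc (disjoint φ p q)

  constant : ∀ {s} → 0# ≤ s → SimpleFunction
  constant {s} 0≤s = record
    { size = 1 ; piece = λ _ → U ; measurable = λ _ → measurable-U
    ; covering = λ _ → zero , tt ; disjoint = λ { {zero} {zero} _ _ → ≡.refl }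
    ; value = λ _ → s ; nonNeg = λ _ → 0≤s }

  module _ {T : Ω → ℝ} (measurable-T : IsRandomVariable T) (0≤T : ∀ ω → 0# ≤ T ω) where
    private
      F : ℝ → ℝ
      F t = ℙ λ ω → T ω ≤ t

      F-mono : ∀ {s t} → s ≤ t → F s ≤ F t
      F-mono {s} {t} s≤t = ℙ-mono (measurable-T s) (measurable-T t) (λ T≤s → ≤.trans T≤s s≤t)

      [T>_] : ℝ → Pred Ω 0ℓ
      [T> s ] = ∁ λ ω → T ω ≤ s

      measurable-T> : ∀ s → Measurable [T> s ]
      measurable-T> s = measurable-∁ (measurable-T s)

    module _ {H : ℝ → ℝ} (brackets : Brackets F H) {M : ℝ} (0≤M : 0# ≤ M) (T≤M : F M ≈ 1#) where

      private
        F-gap≤1 : F M - F 0# ≤ 1#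
        F-gap≤1 = ≤.trans (x-y≤x (ℙ-nonNeg (measurable-T 0#))) (≤.reflexive T≤M)

      -- K t = ∫ φ over {T ≤ t} satisfies K t - K s ≤ t (F t - F s), so K - H grows
      -- by at most mesh times the increment of F along a partition.
      simple≤ : ∀ φ → Below φ T → integral φ ≤ H M - H 0#
      simple≤ φ below = begin
        integral φ
          ≈⟨ sum-cong (λ i → *-congˡ (ℙ-∩-almostSure (measurable φ i) (measurable-T M) T≤M)) ⟩
        K M                                   ≤⟨ ≤-from-gap (+-nonNeg (0≤y-x G-gap≤0) (0≤y-x K0≤0))
          (solve 4 (λ km k0 hm h0 → (hm :- h0) :- km :=
               (con (+ 0) :- ((km :- hm) :- (k0 :- h0))) :+ (con (+ 0) :- k0)) refl (K M) (K 0#) (H M) (H 0#)) ⟩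
        H M - H 0#                            ∎
        where
        Q : Fin (size φ) → ℝ → ℝ
        Q i t = ℙ (piece φ i ∩ λ ω → T ω ≤ t)
        measurable-Q : ∀ i t → Measurable (piece φ i ∩ λ ω → T ω ≤ t)
        measurable-Q i t = measurable-∩ (measurable φ i) (measurable-T t)
        K G : ℝ → ℝ
        K t = sum λ i → value φ i * Q i t
        G t = K t - H t

        Q-vanishes : ∀ i {t} → ¬ (value φ i ≤ t) → Q i t ≈ 0#
        Q-vanishes i {t} v≰t = ℙ-empty (measurable-Q i t) λ (p , T≤t) → v≰t (≤.trans (below p) T≤t)

        -- Since `φ` is below `T`, a piece with positive value does not meet `{T ≤ 0}`.
        K0≤0 : K 0# ≤ 0#
        K0≤0 = ≤.trans (sum-mono λ i → term i) (≤.reflexive (sum-zero {size φ} λ _ → refl))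
          where
          term : ∀ i → value φ i * Q i 0# ≤ 0#
          term i with value φ i ≤? 0#
          ... | yes v≤0 = ≤.trans (*-monoʳ-≤ (ℙ-nonNeg (measurable-Q i 0#)) v≤0) (≤.reflexive (zeroˡ _))
          ... | no v≰0  = ≤.reflexive (trans (*-congˡ (Q-vanishes i v≰0)) (zeroʳ _))

        K-increment : ∀ {s t} → s ≤ t → K t - K s ≤ t * (F t - F s)
        K-increment {s} {t} s≤t = begin
          K t - K s
            ≈⟨ sum-sub (λ i → value φ i * Q i t) (λ i → value φ i * Q i s) ⟨
          sum (λ i → value φ i * Q i t - value φ i * Q i s)
            ≤⟨ sum-mono term ⟩
          sum (λ i → t * (Q i t - Q i s))
            ≈⟨ *-distribˡ-sum t (λ i → Q i t - Q i s) ⟨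
          t * sum (λ i → Q i t - Q i s)
            ≈⟨ *-congˡ (sum-sub (λ i → Q i t) (λ i → Q i s)) ⟩
          t * (sum (λ i → Q i t) - sum (λ i → Q i s))
            ≈⟨ *-congˡ (+-cong (total t) (-‿cong (total s))) ⟩
          t * (F t - F s) ∎
          where
          open import Algebra.Properties.Semiring.Sum semiring using (*-distribˡ-sum)
          total : ∀ r → sum (λ i → Q i r) ≈ F r
          total r = ℙ-pieces (measurable φ) (disjoint φ) (measurable-T r) (λ {ω} _ → covering φ ω)
          Q-mono : ∀ i → Q i s ≤ Q i t
          Q-mono i = ℙ-mono (measurable-Q i s) (measurable-Q i t) (λ (p , T≤s) → p , ≤.trans T≤s s≤t)
          term : ∀ i → value φ i * Q i t - value φ i * Q i s ≤ t * (Q i t - Q i s)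
          term i = ≤.trans
            (≤.reflexive (solve 3 (λ v x y → v :* x :- v :* y :=
                 v :* (x :- y)) refl (value φ i) (Q i t) (Q i s)))
            bound
            where
            -- A piece with value above `t` does not meet `{T ≤ t}`, so both sides vanish; for the
            -- others the values compare directly.
            bound : value φ i * (Q i t - Q i s) ≤ t * (Q i t - Q i s)
            bound with value φ i ≤? t
            ... | yes v≤t = *-monoʳ-≤ (0≤y-x (Q-mono i)) v≤t
            ... | no v≰t = ≤.reflexive (trans (vanish (value φ i)) (sym (vanish t)))
              where
              vanish : ∀ x → x * (Q i t - Q i s) ≈ 0#
              vanish x = trans
                (*-congˡ (+-cong (Q-vanishes i v≰t) (-‿cong (Q-vanishes i λ v≤s → v≰t (≤.trans v≤s s≤t)))))
                (solve 1 (λ x → x :* (con (+ 0) :- con (+ 0)) := con (+ 0)) refl x)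

        -- The upper bound for `K` has the factor `t`, the lower bound for `H` the factor `s`; what
        -- remains is of second order in the cell.
        G-increment : ∀ {s t} → 0# ≤ s → s ≤ t → F s ≤ F t × G t - G s ≤ (t - s) * (F t - F s)
        G-increment {s} {t} 0≤s s≤t = F-mono s≤t ,
          ≤-from-gap (+-nonNeg (0≤y-x (K-increment s≤t)) (0≤y-x (proj₁ (brackets 0≤s s≤t))))
            (solve 7 (λ s t f k k′ h h′ →
                (t :- s) :* f :- ((k′ :- h′) :- (k :- h)) :=
                     (t :* f :- (k′ :- k)) :+ ((h′ :- h) :- s :* f))
              refl s t (F t - F s) (K s) (K t) (H s) (H t))

        G-gap≤0 : G M - G 0# ≤ 0#
        G-gap≤0 = ≤-vanishing 0≤1 λ δ 0<δ →
          let p , mesh = partition-exists 0<δ 0≤M in begin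
          G M - G 0#          ≤⟨ telescope G-increment ≤.refl (proj₁ 0<δ) p mesh ⟩
          δ * (F M - F 0#)    ≤⟨ *-monoˡ-≤ (proj₁ 0<δ) F-gap≤1 ⟩
          δ * 1#              ≈⟨ *-comm δ 1# ⟩
          1# * δ              ∎

      private
        BelowBeyond : ℝ → SimpleFunction → Set _
        BelowBeyond s φ = ∀ {i ω} → piece φ i ω → [T> s ] ω → value φ i ≤ T ω

        integralBeyond : ℝ → SimpleFunction → ℝ
        integralBeyond s φ = sum λ i → value φ i * ℙ (piece φ i ∩ [T> s ])

      -- A staircase built from the right: the event `{T ≤ v}` receives the value `s`, which lies
      -- below `T` only where `T > s`. Restricting the claim to `{T > s}` makes the recursion close.
      -- On a cell, `H v - H s` is at most `v` times the increment of `F`, and lowering `v` to `s`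
      -- costs at most `δ` times it.
      lowerApproximation : ∀ {δ s} → 0# ≤ s → (p : TaggedPartition M s) → MeshBelow δ p →
        Σ[ φ ∈ SimpleFunction ] (BelowBeyond s φ ×
          (H M - H s) - δ * (F M - F s) ≤ integralBeyond s φ)
      lowerApproximation {δ} {s} 0≤s (end s≈M) _ =
        -- Here `F M` equals `F s`, so the quantity to be reached is at most zero and any
        -- nonnegative integral suffices.
        constant 0≤s ,
        (λ _ T≰s → proj₁ (≰⇒> T≰s)) ,
        (begin
          (H M - H s) - δ * (F M - F s)
            ≤⟨ +-mono-≤ (proj₂ (brackets 0≤s (≤.reflexive s≈M))) ≤.refl ⟩
          M * (F M - F s) - δ * (F M - F s)   ≈⟨ +-cong (*-congˡ flat) (-‿cong (*-congˡ flat)) ⟩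
          M * 0# - δ * 0#
            ≈⟨ solve 2 (λ m d → m :* con (+ 0) :- d :* con (+ 0) := con (+ 0)) refl M δ ⟩
          0#
            ≤⟨ sum-nonNeg {1} (λ _ → *-nonNeg 0≤s (ℙ-nonNeg (measurable-∩ measurable-U (measurable-T> s)))) ⟩
          integralBeyond s (constant 0≤s)     ∎)
        where
        flat : F M - F s ≈ 0#
        flat = trans (+-congʳ (ℙ-cong (measurable-T M)
          ((λ T≤M → ≤.trans T≤M (≤.reflexive (sym s≈M))) , λ T≤s → ≤.trans T≤s (≤.reflexive s≈M))))
          (-‿inverseʳ (F s))
      lowerApproximation {δ} {s} 0≤s (cell v t s≤t t≤v p) ((v-s≤δ , _) , mesh)
        with lowerApproximation (≤.trans 0≤s (≤.trans s≤t t≤v)) p mesh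
      ... | φ , below , bound =
        prepend (measurable-T v) 0≤s φ ,
        (λ { {zero} _ T≰s → proj₁ (≰⇒> T≰s) ; {suc i} (T≰v , q) _ → below q T≰v }) ,
        (begin
          (H M - H s) - δ * (F M - F s)
            ≤⟨ ≤-from-gap
                 (+-nonNeg (0≤y-x (proj₂ (brackets 0≤s s≤v))) (*-nonNeg (0≤y-x v-s≤δ) (0≤y-x (F-mono s≤v))))
                 (solve 9 (λ s v d fs fv fM hs hv hM →
                    (s :* (fv :- fs) :+ ((hM :- hv) :- d :* (fM :- fv))) :- ((hM :- hs) :- d :* (fM :- fs)) :=
                    (v :* (fv :- fs) :- (hv :- hs)) :+ (d :- (v :- s)) :* (fv :- fs)) refl
                    s v δ (F s) (F v) (F M) (H s) (H v) (H M)) ⟩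
          s * (F v - F s) + ((H M - H v) - δ * (F M - F v))
            ≤⟨ +-mono-≤ ≤.refl bound ⟩
          s * (F v - F s) + integralBeyond v φ
            ≈⟨ +-cong (*-congˡ (sym (ℙ-∖ (measurable-T s) (measurable-T v) (λ T≤s → ≤.trans T≤s s≤v))))
                 (sum-cong λ i → *-congˡ (ℙ-cong (measurable-∩ (measurable φ i) (measurable-T> v))
                   ((λ (q , T≰v) → (T≰v , q) , λ T≤s → T≰v (≤.trans T≤s s≤v)) , λ ((T≰v , q) , _) → q , T≰v))) ⟩
          integralBeyond s (prepend (measurable-T v) 0≤s φ) ∎)
        where s≤v = ≤.trans s≤t t≤v

      expectation-from-cdf : HasExpectation T (H M - H 0#)
      expectation-from-cdf = record
        { isRandomVariable = measurable-T
        ; nonNegative      = 0≤T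
        ; isLub            = record
          { upper = λ (φ , below , s≈) → ≤.trans (≤.reflexive s≈) (simple≤ φ below)
          ; least = λ bounded → x-y≤0⇒x≤y (≤-vanishing 0≤1 λ δ 0<δ → gap bounded δ 0<δ)
          }
        }
        where
        gap : ∀ {u} → (∀ {x} → Σ[ φ ∈ SimpleFunction ] (Below φ T × x ≈ integral φ) → x ≤ u) →
          ∀ δ → 0# < δ → (H M - H 0#) - u ≤ 1# * δ
        gap {u} bounded δ (0≤δ , δ≉0) with partition-exists (0≤δ , δ≉0) 0≤M
        ... | p , mesh with lowerApproximation ≤.refl p mesh
        ...   | φ , below , bound =
          ≤-from-gap (+-nonNeg (0≤y-x E≤u) (*-nonNeg 0≤δ (0≤y-x F-gap≤1)))
            (solve 4 (λ h u d f → con (+ 1) :* d :- (h :- u) :=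
                 (u :- (h :- d :* f)) :+ d :* (con (+ 1) :- f)) refl
              (H M - H 0#) u δ (F M - F 0#))
          where
          -- `φ` is controlled only where `T > 0`. The value zero on `{T ≤ 0}` puts `ψ` below `T`
          -- everywhere and adds nothing to the integral.
          ψ = prepend (measurable-T 0#) ≤.refl φ
          E≤u : (H M - H 0#) - δ * (F M - F 0#) ≤ u
          E≤u = begin
            (H M - H 0#) - δ * (F M - F 0#)   ≤⟨ bound ⟩
            integralBeyond 0# φ               ≈⟨ +-identityˡ _ ⟨
            0# + integralBeyond 0# φ          ≈⟨ +-cong (sym (zeroˡ (F 0#)))
              (sum-cong λ i → *-congˡ (ℙ-cong (measurable-∩ (measurable φ i) (measurable-T> 0#))
                ((λ (q , T≰0) → T≰0 , q) , λ (T≰0 , q) → q , T≰0))) ⟩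
            integral ψ                        ≤⟨ bounded (ψ , (λ {i} → ψ-below {i}) , refl) ⟩
            u                                 ∎
            where
            ψ-below : Below ψ T
            ψ-below {zero}  {ω} _         = 0≤T ω
            ψ-below {suc i} {ω} (T≰0 , q) = below q T≰0

  -- p moves only where it equals the identity, whence ∫ x dp = ½ p².
  Tracks : (ℝ → ℝ) → Set
  Tracks p = ∀ {s t} → s ≤ t → p s ≈ p t ⊎ (s ≤ p s × p s ≤ p t × p t ≤ t)

  -- When `[s, t]` meets `[a, b]`, `s` may still lie left of `a` or `t` right of `b`; the clipped
  -- values then remain within `[s, t]`, which is why `Tracks` asks for inequalities and not for
  -- equality with the identity.
  tracks-clip : ∀ {a b} → a ≤ b → Tracks (clip a b)
  tracks-clip {a} {b} a≤b {s} {t} s≤t with ≤.total t a | ≤.total b s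
  ... | inj₁ t≤a | _ = inj₁ (trans (clip-below a≤b (≤.trans s≤t t≤a)) (sym (clip-below a≤b t≤a)))
  ... | _ | inj₁ b≤s = inj₁ (trans (clip-above a≤b b≤s) (sym (clip-above a≤b (≤.trans b≤s s≤t))))
  ... | inj₂ a≤t | inj₂ s≤b = inj₂
    ( ≤.trans (⊓-glb ≤.refl s≤b) (x≤y⊔x a (s ⊓ b))
    , clip-mono a≤b s≤t
    , ⊔-lub a≤t (x⊓y≤x t b))

  tracks-⊓ : ∀ τ → Tracks (_⊓ τ)
  tracks-⊓ τ {s} {t} s≤t with ≤.total τ s
  ... | inj₁ τ≤s = inj₁ (trans (x≤y⇒y⊓x≈x τ≤s) (sym (x≤y⇒y⊓x≈x (≤.trans τ≤s s≤t))))
  ... | inj₂ s≤τ = inj₂ (⊓-glb ≤.refl s≤τ , ⊓-monoˡ-≤ τ s≤t , x⊓y≤x t τ)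

  tracks-∘ : ∀ {p q} → (∀ {x y} → x ≈ y → p x ≈ p y) → Tracks p → Tracks q → Tracks (p ∘ q)
  tracks-∘ p-cong P Q s≤t with Q s≤t
  ... | inj₁ qs≈qt = inj₁ (p-cong qs≈qt)
  ... | inj₂ (s≤qs , qs≤qt , qt≤t) with P qs≤qt
  ...   | inj₁ eq = inj₁ eq
  ...   | inj₂ (qs≤pqs , mono , pqt≤qt) = inj₂ (≤.trans s≤qs qs≤pqs , mono , ≤.trans pqt≤qt qt≤t)

  tracks-shift : ∀ {p} τ → Tracks p → Tracks (λ t → τ + p (t - τ))
  tracks-shift {p} τ P {s} {t} s≤t with P (-‿mono-≤ s≤t (≤.refl {τ}))
  ... | inj₁ eq = inj₁ (+-congˡ eq)
  ... | inj₂ (s-τ≤ , mono , ≤t-τ) = inj₂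
    ( ≤-from-gap (0≤y-x s-τ≤) (solve 3 (λ s τ x → (τ :+ x) :- s := x :- (s :- τ)) refl s τ (p (s - τ)))
    , +-monoʳ-≤ τ mono
    , ≤-from-gap (0≤y-x ≤t-τ) (solve 3 (λ t τ x → t :- (τ :+ x) := (t :- τ) :- x) refl t τ (p (t - τ))))

  -- The difference of half squares is the increment of `p` times the midpoint of `p s` and `p t`,
  -- and this midpoint lies between `s` and `t`.
  tracks⇒brackets : ∀ {p} → Tracks p → Brackets p (λ t → ½ * p t ²)
  tracks⇒brackets {p} P {s} {t} _ s≤t with P s≤t
  ... | inj₁ ps≈pt = ≤.reflexive (trans (flat s) (sym gap)) , ≤.reflexive (trans gap (sym (flat t)))
    where
    flat : ∀ x → x * (p t - p s) ≈ 0#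
    flat x = trans (*-congˡ (trans (+-congˡ (-‿cong ps≈pt)) (-‿inverseʳ (p t)))) (zeroʳ x)
    gap : ½ * p t ² - ½ * p s ² ≈ 0#
    gap = trans (+-congˡ (-‿cong (*-congˡ (*-cong ps≈pt ps≈pt)))) (-‿inverseʳ _)
  ... | inj₂ (s≤ps , ps≤pt , pt≤t) =
    ≤-from-gap
      (*-nonNeg (*-nonNeg 0≤½ (0≤y-x ps≤pt)) (+-nonNeg (0≤y-x (≤.trans s≤ps ps≤pt)) (0≤y-x s≤ps)))
      (trans (+-congˡ (-‿cong (sym (½-twice _))))
        (solve 4 (λ h s x y → (h :* (y :* y) :- h :* (x :* x)) :- (h :+ h) :* (s :* (y :- x)) :=
          h :* (y :- x) :* ((y :- s) :+ (x :- s))) refl ½ s (p s) (p t))) ,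
    ≤-from-gap
      (*-nonNeg (*-nonNeg 0≤½ (0≤y-x ps≤pt)) (+-nonNeg (0≤y-x pt≤t) (0≤y-x (≤.trans ps≤pt pt≤t))))
      (trans (+-congʳ (sym (½-twice _)))
        (solve 4 (λ h t x y → (h :+ h) :* (t :* (y :- x)) :- (h :* (y :* y) :- h :* (x :* x)) :=
          h :* (y :- x) :* ((t :- y) :+ (t :- x))) refl ½ t (p s) (p t)))
    where 0≤½ = proj₁ 0<½

  brackets-linear : ∀ {F G H K α β} → 0# ≤ α → 0# ≤ β → Brackets F H → Brackets G K →
    Brackets (λ t → α * F t + β * G t) (λ t → α * H t + β * K t)
  brackets-linear {F} {G} {H} {K} {α} {β} 0≤α 0≤β FH GK {s} {t} 0≤s s≤t with FH 0≤s s≤t | GK 0≤s s≤t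
  ... | F⁻ , F⁺ | G⁻ , G⁺ =
    (begin
      s * ((α * F t + β * G t) - (α * F s + β * G s))
        ≈⟨ *-congˡ (linear-gap (F t) (F s) (G t) (G s)) ⟩
      s * (α * (F t - F s) + β * (G t - G s))            ≈⟨ scale s (F t - F s) (G t - G s) ⟩
      α * (s * (F t - F s)) + β * (s * (G t - G s))
        ≤⟨ +-mono-≤ (*-monoˡ-≤ 0≤α F⁻) (*-monoˡ-≤ 0≤β G⁻) ⟩
      α * (H t - H s) + β * (K t - K s)                  ≈⟨ linear-gap (H t) (H s) (K t) (K s) ⟨
      (α * H t + β * K t) - (α * H s + β * K s)          ∎) ,
    (begin
      (α * H t + β * K t) - (α * H s + β * K s)          ≈⟨ linear-gap (H t) (H s) (K t) (K s) ⟩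
      α * (H t - H s) + β * (K t - K s)
        ≤⟨ +-mono-≤ (*-monoˡ-≤ 0≤α F⁺) (*-monoˡ-≤ 0≤β G⁺) ⟩
      α * (t * (F t - F s)) + β * (t * (G t - G s))      ≈⟨ scale t (F t - F s) (G t - G s) ⟨
      t * (α * (F t - F s) + β * (G t - G s))
        ≈⟨ *-congˡ (linear-gap (F t) (F s) (G t) (G s)) ⟨
      t * ((α * F t + β * G t) - (α * F s + β * G s))    ∎)
    where
    scale : ∀ x f g → x * (α * f + β * g) ≈ α * (x * f) + β * (x * g)
    scale = solve 5 (λ a b x f g → x :* (a :* f :+ b :* g) := a :* (x :* f) :+ b :* (x :* g)) refl α β
    linear-gap : ∀ x y z w → (α * x + β * z) - (α * y + β * w) ≈ α * (x - y) + β * (z - w)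
    linear-gap = solve 6 (λ a b x y z w → (a :* x :+ b :* z) :- (a :* y :+ b :* w) :=
         a :* (x :- y) :+ b :* (z :- w))
      refl α β

  brackets-weighted : ∀ {N} {κ : Fin N → ℝ} {F H : Fin N → ℝ → ℝ} → (∀ n → 0# ≤ κ n) →
    (∀ n → Brackets (F n) (H n)) →
    Brackets (λ t → sum λ n → κ n * F n t) (λ t → sum λ n → κ n * H n t)
  brackets-weighted {zero} _ _ {s} {t} _ _ =
    ≤.reflexive (solve 1 (λ s → s :* (con (+ 0) :- con (+ 0)) := con (+ 0) :- con (+ 0)) refl s) ,
    ≤.reflexive (solve 1 (λ t → con (+ 0) :- con (+ 0) := t :* (con (+ 0) :- con (+ 0))) refl t)
  brackets-weighted {suc N} {κ} {F} {H} 0≤κ FH {s} {t} 0≤s s≤t =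
    (begin
      s * ((κ zero * F zero t + ΣF t) - (κ zero * F zero s + ΣF s))
        ≈⟨ *-congˡ (gap (κ zero * F zero t) (κ zero * F zero s) (ΣF t) (ΣF s)) ⟨
      s * ((κ zero * F zero t + 1# * ΣF t) - (κ zero * F zero s + 1# * ΣF s))
        ≤⟨ proj₁ (combined 0≤s s≤t) ⟩
      (κ zero * H zero t + 1# * ΣH t) - (κ zero * H zero s + 1# * ΣH s)
        ≈⟨ gap (κ zero * H zero t) (κ zero * H zero s) (ΣH t) (ΣH s) ⟩
      (κ zero * H zero t + ΣH t) - (κ zero * H zero s + ΣH s)                      ∎) ,
    (begin
      (κ zero * H zero t + ΣH t) - (κ zero * H zero s + ΣH s)
        ≈⟨ gap (κ zero * H zero t) (κ zero * H zero s) (ΣH t) (ΣH s) ⟨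
      (κ zero * H zero t + 1# * ΣH t) - (κ zero * H zero s + 1# * ΣH s)
        ≤⟨ proj₂ (combined 0≤s s≤t) ⟩
      t * ((κ zero * F zero t + 1# * ΣF t) - (κ zero * F zero s + 1# * ΣF s))
        ≈⟨ *-congˡ (gap (κ zero * F zero t) (κ zero * F zero s) (ΣF t) (ΣF s)) ⟩
      t * ((κ zero * F zero t + ΣF t) - (κ zero * F zero s + ΣF s))                ∎)
    where
    ΣF ΣH : ℝ → ℝ
    ΣF x = sum λ n → κ (suc n) * F (suc n) x
    ΣH x = sum λ n → κ (suc n) * H (suc n) x
    combined : Brackets (λ x → κ zero * F zero x + 1# * ΣF x) (λ x → κ zero * H zero x + 1# * ΣH x)
    combined = brackets-linear {F zero} {ΣF} {H zero} {ΣH} (0≤κ zero) 0≤1 (FH zero)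
      (brackets-weighted (λ n → 0≤κ (suc n)) (λ n → FH (suc n)))
    gap : ∀ x y z w → (x + 1# * z) - (y + 1# * w) ≈ (x + z) - (y + w)
    gap = solve 4 (λ x y z w → (x :+ con (+ 1) :* z) :- (y :+ con (+ 1) :* w) :=
         (x :+ z) :- (y :+ w)) refl

  -- `Brackets` sees only increments over nonnegative arguments, so an additive constant is lost and
  -- a formula for `t ≥ 0` is enough.
  brackets-resp : ∀ {F G H κ} → (∀ {t} → 0# ≤ t → G t ≈ F t - κ) → Brackets F H → Brackets G H
  brackets-resp {F} {G} {H} {κ} G≈F-κ FH {s} {t} 0≤s s≤t with FH 0≤s s≤t
  ... | lower , upper =
    ≤.trans (≤.reflexive (*-congˡ gap)) lower , ≤.trans upper (≤.reflexive (*-congˡ (sym gap)))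
    where
    gap : G t - G s ≈ F t - F s
    gap = trans (+-cong (G≈F-κ (≤.trans 0≤s s≤t)) (-‿cong (G≈F-κ 0≤s)))
      (solve 3 (λ x y k → (x :- k) :- (y :- k) := x :- y) refl (F t) (F s) κ)

  hasExpectation-resp : ∀ {X e e′} → e ≈ e′ → HasExpectation X e → HasExpectation X e′
  hasExpectation-resp e≈e′ E = record
    { isRandomVariable = isRandomVariable
    ; nonNegative      = nonNegative
    ; isLub            = record
      { upper = λ x∈S → ≤.trans (IsLub.upper isLub x∈S) (≤.reflexive e≈e′)
      ; least = λ bounded → ≤.trans (≤.reflexive (sym e≈e′)) (IsLub.least isLub bounded)
      }
    }
    where open HasExpectation E

-- Distribution and mean of the derived time

module DerivedTimeMean (em : ExcludedMiddle 0ℓ) {ℛ : CompleteOrderedField} {o ℓ} (𝒫 : ProbabilitySpace ℛ o ℓ) where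
  open CompleteOrderedField ℛ hiding (zero)
  open ProbabilitySpace 𝒫
  open Probability 𝒫
  open IntegerSolver commutativeRing
  open OrderedField ℛ
  open RiemannSums em ℛ
  open Events em 𝒫
  open Expectation em 𝒫
  open import Relation.Binary.Reasoning.PartialOrder (DecTotalOrder.poset decTotalOrder)

  module DerivedTime
    {X Y : Ω → ℝ} (mX : IsRandomVariable X) (mY : IsRandomVariable Y)
    (0≤X : ∀ ω → 0# ≤ X ω) (0≤Y : ∀ ω → 0# ≤ Y ω) {τ : ℝ} (0≤τ : 0# ≤ τ)
    where

    T : Ω → ℝ
    T = derivedTime X Y τ

    T-early : ∀ {ω} → X ω ≤ τ → T ω ≈ X ω
    T-early {ω} X≤τ = if-yes (X ω ≤? τ) X≤τ

    T-late : ∀ {ω} → ¬ (X ω ≤ τ) → T ω ≈ τ + Y ω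
    T-late {ω} X≰τ = if-no (X ω ≤? τ) X≰τ

    τ+y≤t⇔ : ∀ {t y} → (τ + y ≤ t → y ≤ t - τ) × (y ≤ t - τ → τ + y ≤ t)
    τ+y≤t⇔ {t} {y} =
      (λ h → ≤-from-gap (0≤y-x h) (solve 3 (λ t τ y → (t :- τ) :- y := t :- (τ :+ y)) refl t τ y)) ,
      (λ h → ≤-from-gap (0≤y-x h) (solve 3 (λ t τ y → t :- (τ :+ y) := (t :- τ) :- y) refl t τ y))

    T≤t-early : ∀ t → (λ ω → X ω ≤ t ⊓ τ) ≐ ((λ ω → T ω ≤ t) ∩ λ ω → X ω ≤ τ)
    T≤t-early t =
      (λ X≤t⊓τ → let X≤τ = ≤.trans X≤t⊓τ (x⊓y≤y t τ) in
        ≤.trans (≤.reflexive (T-early X≤τ)) (≤.trans X≤t⊓τ (x⊓y≤x t τ)) , X≤τ) ,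
      (λ (T≤t , X≤τ) → ⊓-glb (≤.trans (≤.reflexive (sym (T-early X≤τ))) T≤t) X≤τ)

    T≤t-late : ∀ t → ((λ ω → Y ω ≤ t - τ) ∩ ∁ λ ω → X ω ≤ τ) ≐ ((λ ω → T ω ≤ t) ∩ ∁ λ ω → X ω ≤ τ)
    T≤t-late t =
      (λ (Y≤ , X≰τ) → ≤.trans (≤.reflexive (T-late X≰τ)) (proj₂ τ+y≤t⇔ Y≤) , X≰τ) ,
      (λ (T≤t , X≰τ) → proj₁ τ+y≤t⇔ (≤.trans (≤.reflexive (sym (T-late X≰τ))) T≤t) , X≰τ)

    measurable-late : ∀ t → Measurable ((λ ω → Y ω ≤ t - τ) ∩ ∁ λ ω → X ω ≤ τ)
    measurable-late t = measurable-∩ (mY (t - τ)) (measurable-∁ (mX τ))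

    measurable-T : IsRandomVariable T
    measurable-T t = measurable-≐ (to , from) (measurable-∪ (mX (t ⊓ τ)) (measurable-late t))
      where
      to : ((λ ω → X ω ≤ t ⊓ τ) ∪ ((λ ω → Y ω ≤ t - τ) ∩ ∁ λ ω → X ω ≤ τ)) ⊆ (λ ω → T ω ≤ t)
      to (inj₁ early) = proj₁ (proj₁ (T≤t-early t) early)
      to (inj₂ late)  = proj₁ (proj₁ (T≤t-late t) late)
      from : (λ ω → T ω ≤ t) ⊆ ((λ ω → X ω ≤ t ⊓ τ) ∪ ((λ ω → Y ω ≤ t - τ) ∩ ∁ λ ω → X ω ≤ τ))
      from {ω} T≤t with em {P = X ω ≤ τ}
      ... | yes X≤τ = inj₁ (proj₂ (T≤t-early t) (T≤t , X≤τ))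
      ... | no  X≰τ = inj₂ (proj₂ (T≤t-late t) (T≤t , X≰τ))

    0≤T : ∀ ω → 0# ≤ T ω
    0≤T ω with em {P = X ω ≤ τ}
    ... | yes X≤τ = ≤.trans (0≤X ω) (≤.reflexive (sym (T-early X≤τ)))
    ... | no  X≰τ = ≤.trans (+-nonNeg 0≤τ (0≤Y ω)) (≤.reflexive (sym (T-late X≰τ)))

    T-cdf : ∀ t → ℙ (λ ω → T ω ≤ t) ≈
      ℙ (λ ω → X ω ≤ t ⊓ τ) + ℙ ((λ ω → Y ω ≤ t - τ) ∩ ∁ λ ω → X ω ≤ τ)
    T-cdf t = trans (ℙ-split (measurable-T t) (mX τ))
      (+-cong (sym (ℙ-cong (mX (t ⊓ τ)) (T≤t-early t))) (sym (ℙ-cong (measurable-late t) (T≤t-late t))))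

    module _ {N} {k a b c d : Fin N → ℝ}
      (0≤a<b : ∀ n → 0# ≤ a n × a n < b n) (0≤c<d : ∀ n → 0# ≤ c n × c n < d n) (0<k : ∀ n → 0# < k n)
      (total : sum (λ n → k n * (b n - a n) * (d n - c n)) ≈ 1#)
      (density : HasJointDensity X Y (λ x y → sum λ n →
        k n * indicator (a n ≤? x ×-dec x <? b n) * indicator (c n ≤? y ×-dec y <? d n)))
      where

      private
        0≤a : ∀ n → 0# ≤ a n
        0≤a n = proj₁ (0≤a<b n)
        a≤b : ∀ n → a n ≤ b n
        a≤b n = proj₁ (proj₂ (0≤a<b n))
        0≤c : ∀ n → 0# ≤ c n
        0≤c n = proj₁ (0≤c<d n)
        c≤d : ∀ n → c n ≤ d n
        c≤d n = proj₁ (proj₂ (0≤c<d n))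
        0≤k : ∀ n → 0# ≤ k n
        0≤k n = proj₁ (0<k n)

        A C : Fin N → ℝ → ℝ
        A n = clip (a n) (b n)
        C n = clip (c n) (d n)

        -- A crude common bound of all `b n` and `d n`; the density vanishes outside the square with
        -- this side.
        D : ℝ
        D = sum (λ n → b n) + sum (λ n → d n)
        0≤b : ∀ n → 0# ≤ b n
        0≤b n = ≤.trans (0≤a n) (a≤b n)
        0≤d : ∀ n → 0# ≤ d n
        0≤d n = ≤.trans (0≤c n) (c≤d n)
        0≤D : 0# ≤ D
        0≤D = +-nonNeg (sum-nonNeg 0≤b) (sum-nonNeg 0≤d)
        b≤D : ∀ n → b n ≤ D
        b≤D n = ≤.trans (term≤sum 0≤b n) (x≤x+y (sum-nonNeg 0≤d))
        d≤D : ∀ n → d n ≤ D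
        d≤D n = ≤.trans (term≤sum 0≤d n) (≤.trans (x≤x+y (sum-nonNeg 0≤b)) (≤.reflexive (+-comm _ _)))

      joint-measurable : ∀ v t → Measurable (λ ω → X ω ≤ v × Y ω ≤ t)
      joint-measurable v t = measurable-∩ (mX v) (mY t)

      -- Both times are nonnegative, so the event is a rectangle with corner at the origin, where
      -- the clips take the values `a n` and `c n`.
      joint-cdf : ∀ {v t} → 0# ≤ v → 0# ≤ t →
        ℙ (λ ω → X ω ≤ v × Y ω ≤ t) ≈ sum λ n → k n * (C n t - c n) * (A n v - a n)
      joint-cdf {v} {t} 0≤v 0≤t = trans
        (ℙ-cong (joint-measurable v t)
          ((λ {ω} (X≤v , Y≤t) → (0≤X ω , X≤v) , (0≤Y ω , Y≤t)) , λ ((_ , X≤v) , (_ , Y≤t)) → X≤v , Y≤t))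
        (trans (rectangles-integral 0≤k a≤b c≤d 0≤v 0≤t (density ≤.refl 0≤v ≤.refl 0≤t))
          (sum-cong λ n → *-cong
            (*-congˡ (+-congˡ (-‿cong (clip-below (c≤d n) (0≤c n)))))
            (+-congˡ (-‿cong (clip-below (a≤b n) (0≤a n))))))

      -- From `D` on every clip has reached its upper end, so the probability becomes the normalised
      -- sum.
      bounded-almostSure : ∀ {E} → D ≤ E → ℙ (λ ω → X ω ≤ E × Y ω ≤ E) ≈ 1#
      bounded-almostSure {E} D≤E = begin-equality
        ℙ (λ ω → X ω ≤ E × Y ω ≤ E)                          ≈⟨ joint-cdf 0≤E 0≤E ⟩
        sum (λ n → k n * (C n E - c n) * (A n E - a n))      ≈⟨ sum-cong (λ n → trans
          (*-cong (*-congˡ (+-congʳ (clip-above (c≤d n) (≤.trans (d≤D n) D≤E))))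
                  (+-congʳ (clip-above (a≤b n) (≤.trans (b≤D n) D≤E))))
          (solve 3 (λ k x y → k :* x :* y := k :* y :* x) refl (k n) (d n - c n) (b n - a n))) ⟩
        sum (λ n → k n * (b n - a n) * (d n - c n))          ≈⟨ total ⟩
        1#                                                   ∎
        where 0≤E = ≤.trans 0≤D D≤E

      X-cdf : ∀ {v} → 0# ≤ v → ℙ (λ ω → X ω ≤ v) ≈ sum λ n → k n * (d n - c n) * (A n v - a n)
      X-cdf {v} 0≤v = begin-equality
        ℙ (λ ω → X ω ≤ v)
          ≈⟨ ℙ-∩-almostSure (mX v) (joint-measurable E E) (bounded-almostSure (x≤y⊔x v D)) ⟩
        ℙ ((λ ω → X ω ≤ v) ∩ λ ω → X ω ≤ E × Y ω ≤ E)
          ≈⟨ ℙ-cong (measurable-∩ (mX v) (joint-measurable E E))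
          ((λ (X≤v , _ , Y≤E) → X≤v , Y≤E) , λ (X≤v , Y≤E) → X≤v , ≤.trans X≤v (x≤x⊔y v D) , Y≤E) ⟩
        ℙ (λ ω → X ω ≤ v × Y ω ≤ E)                          ≈⟨ joint-cdf 0≤v (≤.trans 0≤D (x≤y⊔x v D)) ⟩
        sum (λ n → k n * (C n E - c n) * (A n v - a n))      ≈⟨ sum-cong (λ n →
          *-congʳ (*-congˡ (+-congʳ (clip-above (c≤d n) (≤.trans (d≤D n) (x≤y⊔x v D)))))) ⟩
        sum (λ n → k n * (d n - c n) * (A n v - a n))        ∎
        -- At least `D` for the almost sure bound, and at least `v` so that `X ω ≤ v` makes the
        -- constraint `X ω ≤ E` redundant.
        where E = v ⊔ D

      -- Up to a null set the event is the rectangle `X ≤ E`, `Y ≤ r` without the rectangle `X ≤ τ`,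
      -- `Y ≤ r`; in the difference of their probabilities `a n` cancels.
      late-cdf : ∀ r → ℙ ((λ ω → Y ω ≤ r) ∩ ∁ λ ω → X ω ≤ τ) ≈ sum λ n → k n * (C n r - c n) * (b n - A n τ)
      late-cdf r with r <? 0#
      -- Negative `r` does occur: it stands for `t - τ` with `t` before the time limit. The clip
      -- then equals `c n`, and both sides are zero.
      ... | yes r<0 = trans
        (ℙ-empty (measurable-∩ (mY r) (measurable-∁ (mX τ))) λ {ω} (Y≤r , _) → <⇒≱ r<0 (≤.trans (0≤Y ω) Y≤r))
        (sym (sum-zero λ n → trans
          (*-congʳ (*-congˡ (trans (+-congʳ (clip-below (c≤d n) (≤.trans (proj₁ r<0) (0≤c n)))) (-‿inverseʳ (c n)))))
          (trans (*-congʳ (zeroʳ (k n))) (zeroˡ _))))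
      ... | no r≮0 = begin-equality
        ℙ late
          ≈⟨ ℙ-∩-almostSure m-late (joint-measurable E E) (bounded-almostSure (x≤y⊔x (r ⊔ τ) D)) ⟩
        ℙ (late ∩ λ ω → X ω ≤ E × Y ω ≤ E)
          ≈⟨ ℙ-cong (measurable-∩ m-late (joint-measurable E E))
               ((λ ((Y≤r , X≰τ) , X≤E , _) → (X≤E , Y≤r) , λ (X≤τ , _) → X≰τ X≤τ) ,
                (λ ((X≤E , Y≤r) , outside) → (Y≤r , λ X≤τ → outside (X≤τ , Y≤r)) , X≤E , ≤.trans Y≤r r≤E)) ⟩
        ℙ ((λ ω → X ω ≤ E × Y ω ≤ r) ∩ ∁ λ ω → X ω ≤ τ × Y ω ≤ r)
          ≈⟨ ℙ-∖ (joint-measurable τ r) (joint-measurable E r) (λ (X≤τ , Y≤r) → ≤.trans X≤τ τ≤E , Y≤r) ⟩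
        ℙ (λ ω → X ω ≤ E × Y ω ≤ r) - ℙ (λ ω → X ω ≤ τ × Y ω ≤ r)
          ≈⟨ +-cong (joint-cdf (≤.trans 0≤τ τ≤E) 0≤r) (-‿cong (joint-cdf 0≤τ 0≤r)) ⟩
        sum (λ n → k n * (C n r - c n) * (A n E - a n)) - sum (λ n → k n * (C n r - c n) * (A n τ - a n))
          ≈⟨ sum-sub (λ n → k n * (C n r - c n) * (A n E - a n)) (λ n → k n * (C n r - c n) * (A n τ - a n)) ⟨
        sum (λ n → k n * (C n r - c n) * (A n E - a n) - k n * (C n r - c n) * (A n τ - a n))
          ≈⟨ sum-cong (λ n → trans
               (+-congʳ (*-congˡ (+-congʳ (clip-above (a≤b n) (≤.trans (b≤D n) (x≤y⊔x (r ⊔ τ) D))))))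
               (solve 4 (λ w b x a → w :* (b :- a) :- w :* (x :- a) := w :* (b :- x)) refl
                 (k n * (C n r - c n)) (b n) (A n τ) (a n))) ⟩
        sum (λ n → k n * (C n r - c n) * (b n - A n τ)) ∎
        where
        late = (λ ω → Y ω ≤ r) ∩ ∁ λ ω → X ω ≤ τ
        m-late = measurable-∩ (mY r) (measurable-∁ (mX τ))
        -- `D` gives the almost sure bound, `r` makes `Y ω ≤ E` follow from `Y ω ≤ r`, and `τ` nests
        -- the two rectangles.
        E = r ⊔ τ ⊔ D
        r≤E : r ≤ E
        r≤E = ≤.trans (x≤x⊔y r τ) (x≤x⊔y (r ⊔ τ) D)
        τ≤E : τ ≤ E
        τ≤E = ≤.trans (x≤y⊔x r τ) (x≤x⊔y (r ⊔ τ) D)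
        0≤r : 0# ≤ r
        0≤r with ≤.total 0# r
        ... | inj₁ 0≤r = 0≤r
        ... | inj₂ r≤0 with 0# ≟ r
        ...   | yes 0≈r = ≤.reflexive 0≈r
        ...   | no 0≉r  = ⊥-elim (r≮0 (r≤0 , λ r≈0 → 0≉r (sym r≈0)))

      private
        -- For each rectangle, `p n` describes the runs finished by `τ`, weighted by the height
        -- `d n - c n`. The restarted runs are described by `q n`, the clip to `[τ + c n, τ + d n]`,
        -- weighted by the length of `[a n, b n)` beyond `τ`. `F₀ n` is the value of `F n` at `0#`.
        p q F H : Fin N → ℝ → ℝ
        p n t = A n (t ⊓ τ)
        q n t = τ + C n (t - τ)
        F n t = (d n - c n) * p n t + (b n - A n τ) * q n t
        H n t = (d n - c n) * (½ * p n t ²) + (b n - A n τ) * (½ * q n t ²)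
        F₀ : Fin N → ℝ
        F₀ n = (d n - c n) * a n + (b n - A n τ) * (τ + c n)

      derivedTime-cdf : ∀ {t} → 0# ≤ t →
        ℙ (λ ω → T ω ≤ t) ≈ sum (λ n → k n * F n t) - sum (λ n → k n * F₀ n)
      derivedTime-cdf {t} 0≤t = begin-equality
        ℙ (λ ω → T ω ≤ t)
          ≈⟨ T-cdf t ⟩
        ℙ (λ ω → X ω ≤ t ⊓ τ) + ℙ ((λ ω → Y ω ≤ t - τ) ∩ ∁ λ ω → X ω ≤ τ)
          ≈⟨ +-cong (X-cdf (⊓-glb 0≤t 0≤τ)) (late-cdf (t - τ)) ⟩
        sum early + sum late
          ≈⟨ ∑-distrib-+ early late ⟨
        sum (λ n → early n + late n)
          ≈⟨ sum-cong (λ n → trans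
               (+-congˡ (*-congʳ (*-congˡ (solve 3 (λ τ y c → y :- c :=
                    (τ :+ y) :- (τ :+ c)) refl τ (C n (t - τ)) (c n)))))
               (solve 7 (λ k w v x y z r →
                  k :* w :* (x :- z) :+ k :* (y :- r) :* v :=
                       k :* (w :* x :+ v :* y) :- k :* (w :* z :+ v :* r))
                refl (k n) (d n - c n) (b n - A n τ) (p n t) (q n t) (a n) (τ + c n))) ⟩
        sum (λ n → k n * F n t - k n * F₀ n)
          ≈⟨ sum-sub (λ n → k n * F n t) (λ n → k n * F₀ n) ⟩
        sum (λ n → k n * F n t) - sum (λ n → k n * F₀ n) ∎
        where
        open import Algebra.Properties.CommutativeMonoid.Sum +-commutativeMonoid using (∑-distrib-+)
        early late : Fin N → ℝ
        early n = k n * (d n - c n) * (A n (t ⊓ τ) - a n)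
        late n = k n * (C n (t - τ) - c n) * (b n - A n τ)

      derivedTime-brackets : Brackets (λ t → ℙ λ ω → T ω ≤ t) (λ t → sum λ n → k n * H n t)
      derivedTime-brackets =
        brackets-resp {λ t → sum λ n → k n * F n t} {κ = sum λ n → k n * F₀ n} derivedTime-cdf
          (brackets-weighted {κ = k} {F} {H} 0≤k piece)
        where
        p-tracks : ∀ n → Tracks (p n)
        p-tracks n = tracks-∘ {A n} {_⊓ τ} (λ x≈y → ⊔-congˡ (a n) (⊓-congʳ (b n) x≈y))
          (tracks-clip (a≤b n)) (tracks-⊓ τ)
        piece : ∀ n → Brackets (F n) (H n)
        piece n = brackets-linear {p n} {q n} {λ t → ½ * p n t ²} {λ t → ½ * q n t ²}
          (0≤y-x (c≤d n)) (0≤y-x (clip≤b (a≤b n) τ))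
          (tracks⇒brackets {p n} (p-tracks n))
          (tracks⇒brackets {q n} (tracks-shift {C n} τ (tracks-clip (c≤d n))))

      private
        -- Bounds `T` as soon as the second time is at most `D`: an early finish takes at most `τ`,
        -- a restarted run at most `τ + D`.
        M : ℝ
        M = τ + D
        0≤M : 0# ≤ M
        0≤M = +-nonNeg 0≤τ 0≤D
        M-τ≈D : M - τ ≈ D
        M-τ≈D = solve 2 (λ τ D → (τ :+ D) :- τ := D) refl τ D
        pM : ∀ n → p n M ≈ A n τ
        pM n = ⊔-congˡ (a n) (⊓-congʳ (b n) (x≤y⇒y⊓x≈x (x≤x+y 0≤D)))
        p0 : ∀ n → p n 0# ≈ a n
        p0 n = clip-below (a≤b n) (≤.trans (x⊓y≤x 0# τ) (0≤a n))
        qM : ∀ n → q n M ≈ τ + d n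
        qM n = +-congˡ (clip-above (c≤d n) (≤.trans (d≤D n) (≤.reflexive (sym M-τ≈D))))
        q0 : ∀ n → q n 0# ≈ τ + c n
        q0 n = +-congˡ (clip-below (c≤d n) (≤.trans (x-y≤x 0≤τ) (0≤c n)))

      -- At `M` the early part `A n τ - a n` and the late part `b n - A n τ` both carry the full
      -- height `d n - c n`, so together they restore the mass of the rectangle.
      derivedTime≤M : ℙ (λ ω → T ω ≤ M) ≈ 1#
      derivedTime≤M = begin-equality
        ℙ (λ ω → T ω ≤ M)
          ≈⟨ derivedTime-cdf 0≤M ⟩
        sum (λ n → k n * F n M) - sum (λ n → k n * F₀ n)
          ≈⟨ sum-sub (λ n → k n * F n M) (λ n → k n * F₀ n) ⟨
        sum (λ n → k n * F n M - k n * F₀ n)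
          ≈⟨ sum-cong (λ n → trans
               (+-congʳ (*-congˡ (+-cong (*-congˡ (pM n)) (*-congˡ (qM n)))))
               (solve 7 (λ k a b c d τ z →
                  k :* ((d :- c) :* z :+ (b :- z) :* (τ :+ d)) :- k :* ((d :- c) :* a :+ (b :- z) :* (τ :+ c)) :=
                  k :* (b :- a) :* (d :- c)) refl (k n) (a n) (b n) (c n) (d n) τ (A n τ))) ⟩
        sum (λ n → k n * (b n - a n) * (d n - c n))
          ≈⟨ total ⟩
        1# ∎

      -- The two half differences of squares are the integrals of `x` from `a n` to `A n τ` and of
      -- `τ + y` from `c n` to `d n`: the double integrals for the mean, evaluated on one rectangle.
      derivedTime-expectation : HasExpectation T (sum λ n →
        k n * ((d n - c n) * (½ * (A n τ ² - a n ²)) + (b n - A n τ) * (½ * ((τ + d n) ² - (τ + c n) ²))))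
      derivedTime-expectation = hasExpectation-resp
        (trans (sym (sum-sub (λ n → k n * H n M) (λ n → k n * H n 0#))) (sum-cong λ n → trans
          (+-cong
            (*-congˡ (+-cong (*-congˡ (*-congˡ (*-cong (pM n) (pM n)))) (*-congˡ (*-congˡ (*-cong (qM n) (qM n))))))
            (-‿cong (*-congˡ (+-cong (*-congˡ (*-congˡ (*-cong (p0 n) (p0 n)))) (*-congˡ (*-congˡ (*-cong (q0 n) (q0 n))))))))
          (solve 8 (λ h k w v x y z r →
              k :* (w :* (h :* (x :* x)) :+ v :* (h :* (y :* y))) :- k :* (w :* (h :* (z :* z)) :+ v :* (h :* (r :* r))) :=
              k :* (w :* (h :* (x :* x :- z :* z)) :+ v :* (h :* (y :* y :- r :* r))))
            refl ½ (k n) (d n - c n) (b n - A n τ) (A n τ) (τ + d n) (a n) (τ + c n))))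
        (expectation-from-cdf measurable-T 0≤T derivedTime-brackets 0≤M derivedTime≤M)

-- Rewriting the mean as a polynomial in the time limit

module ClosedForm (em : ExcludedMiddle 0ℓ) (ℛ : CompleteOrderedField) where
  open CompleteOrderedField ℛ hiding (zero)
  open IntegerSolver commutativeRing
  open OrderedField ℛ
  open RiemannSums em ℛ
  open import Relation.Binary.Reasoning.PartialOrder (DecTotalOrder.poset decTotalOrder)

  module _ (τ : ℝ) where
    -- The shape of the final formula with its six sums as arguments. It is linear in them jointly,
    -- so the identity can be checked on a single rectangle.
    combination : (x₁ x₂ x₃ x₄ x₅ x₆ : ℝ) → ℝ
    combination x₁ x₂ x₃ x₄ x₅ x₆ = τ ² * (- (½ * x₁)) + τ * (x₂ + x₃) + ½ * x₄ + ½ * x₅ + ½ * x₆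

    combination-cong : ∀ {x₁ x₂ x₃ x₄ x₅ x₆ y₁ y₂ y₃ y₄ y₅ y₆} →
      x₁ ≈ y₁ → x₂ ≈ y₂ → x₃ ≈ y₃ → x₄ ≈ y₄ → x₅ ≈ y₅ → x₆ ≈ y₆ →
      combination x₁ x₂ x₃ x₄ x₅ x₆ ≈ combination y₁ y₂ y₃ y₄ y₅ y₆
    combination-cong e₁ e₂ e₃ e₄ e₅ e₆ =
      +-cong (+-cong (+-cong (+-cong (*-congˡ (-‿cong (*-congˡ e₁))) (*-congˡ (+-cong e₂ e₃)))
        (*-congˡ e₄)) (*-congˡ e₅)) (*-congˡ e₆)

    combination-sum : ∀ {N} (f₁ f₂ f₃ f₄ f₅ f₆ : Fin N → ℝ) →
      combination (sum f₁) (sum f₂) (sum f₃) (sum f₄) (sum f₅) (sum f₆) ≈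
      sum λ n → combination (f₁ n) (f₂ n) (f₃ n) (f₄ n) (f₅ n) (f₆ n)
    combination-sum {zero} _ _ _ _ _ _ =
      solve 2 (λ τ h → τ :* τ :* (:- (h :* con (+ 0))) :+ τ :* (con (+ 0) :+ con (+ 0))
          :+ h :* con (+ 0) :+ h :* con (+ 0) :+ h :* con (+ 0) := con (+ 0)) refl τ ½
    combination-sum {suc N} f₁ f₂ f₃ f₄ f₅ f₆ = begin-equality
      combination (sum f₁) (sum f₂) (sum f₃) (sum f₄) (sum f₅) (sum f₆)
        ≈⟨ +-cong (+-cong (+-cong (+-cong
             (solve 4 (λ τ h x y → τ :* τ :* (:- (h :* (x :+ y))) :=
                  τ :* τ :* (:- (h :* x)) :+ τ :* τ :* (:- (h :* y))) refl τ ½ (f₁ zero) (sum (f₁ ∘ suc)))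
             (solve 5 (λ τ x y z w → τ :* ((x :+ y) :+ (z :+ w)) :=
                  τ :* (x :+ z) :+ τ :* (y :+ w)) refl τ (f₂ zero) (sum (f₂ ∘ suc)) (f₃ zero) (sum (f₃ ∘ suc))))
             (distribˡ ½ _ _)) (distribˡ ½ _ _)) (distribˡ ½ _ _) ⟩
      (τ ² * (- (½ * f₁ zero)) + τ ² * (- (½ * sum (f₁ ∘ suc))))
        + (τ * (f₂ zero + f₃ zero) + τ * (sum (f₂ ∘ suc) + sum (f₃ ∘ suc)))
        + (½ * f₄ zero + ½ * sum (f₄ ∘ suc)) + (½ * f₅ zero + ½ * sum (f₅ ∘ suc)) + (½ * f₆ zero + ½ * sum (f₆ ∘ suc))
        ≈⟨ interchange₅ ⟩
      combination (f₁ zero) (f₂ zero) (f₃ zero) (f₄ zero) (f₅ zero) (f₆ zero) +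
        combination (sum (f₁ ∘ suc)) (sum (f₂ ∘ suc)) (sum (f₃ ∘ suc)) (sum (f₄ ∘ suc)) (sum (f₅ ∘ suc)) (sum (f₆ ∘ suc))
        ≈⟨ +-congˡ (combination-sum (f₁ ∘ suc) (f₂ ∘ suc) (f₃ ∘ suc) (f₄ ∘ suc) (f₅ ∘ suc) (f₆ ∘ suc)) ⟩
      _ ∎
      where
      open import Algebra.Properties.CommutativeSemigroup +-commutativeSemigroup using (interchange)
      interchange₅ : ∀ {x₁ y₁ x₂ y₂ x₃ y₃ x₄ y₄ x₅ y₅} →
        (x₁ + y₁) + (x₂ + y₂) + (x₃ + y₃) + (x₄ + y₄) + (x₅ + y₅) ≈
        (x₁ + x₂ + x₃ + x₄ + x₅) + (y₁ + y₂ + y₃ + y₄ + y₅)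
      interchange₅ = trans (+-congʳ (trans (+-congʳ (trans (+-congʳ (interchange _ _ _ _))
        (interchange _ _ _ _))) (interchange _ _ _ _))) (interchange _ _ _ _)

    module _ {k a b c d : ℝ} (a<b : a < b) where
      private
        w e : ℝ
        w = d - c
        e = d + c

        low? = τ ≤? a
        mid? = a <? τ ×-dec τ <? b
        high? = b ≤? τ

        contribution : ℝ → ℝ
        contribution z = k * (w * (½ * (z ² - a ²)) + (b - z) * (½ * ((τ + d) ² - (τ + c) ²)))

        -- Factoring the difference of squares lets `c` and `d` enter only through `w` and `e`,
        -- which the polynomial identities below treat as variables.
        contribution-factored : ∀ {z z′} → z ≈ z′ →
          contribution z ≈ k * (w * (½ * (z′ ² - a ²)) + (b - z′) * (½ * (w * (τ + τ + e))))
        contribution-factored z≈z′ = *-congˡ (+-cong (*-congˡ (*-congˡ (+-congʳ (*-cong z≈z′ z≈z′))))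
          (*-cong (+-congˡ (-‿cong z≈z′)) (*-congˡ
            (solve 3 (λ τ c d → (τ :+ d) :* (τ :+ d) :- (τ :+ c) :* (τ :+ c) :=
                 (d :- c) :* (τ :+ τ :+ (d :+ c))) refl τ c d))))

      -- According to the position of `τ` the clip is `a`, `τ` or `b`, and exactly one group of
      -- conditionals survives. The endpoints `τ ≈ a` and `τ ≈ b` belong to the outer cases, which
      -- the strict `a<b` keeps apart.
      contribution≈combination : contribution (clip a b τ) ≈ combination
        (if does mid? then k * (d - c) else 0#)
        (if does low? then k * (b - a) * (d - c) else 0#)
        (if does mid? then k * (b - ½ * (d + c)) * (d - c) else 0#)
        (if does low? then k * (b - a) * (d ² - c ²) else 0#)
        (if does mid? then k * (b * (d + c) - a ²) * (d - c) else 0#)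
        (if does high? then k * (b ² - a ²) * (d - c) else 0#)
      contribution≈combination = by-position (em {P = τ ≤ a}) (em {P = b ≤ τ})
        where
        a≤b = proj₁ a<b
        by-position : Dec (τ ≤ a) → Dec (b ≤ τ) → _
        by-position (yes τ≤a) _ = begin-equality
          contribution (clip a b τ)
            ≈⟨ contribution-factored (clip-below a≤b τ≤a) ⟩
          k * (w * (½ * (a ² - a ²)) + (b - a) * (½ * (w * (τ + τ + e))))
            ≈⟨ solve 7 (λ h k v w e t a →
                 k :* (w :* (h :* (a :* a :- a :* a)) :+ v :* (h :* (w :* (t :+ t :+ e)))) :=
                 t :* t :* (:- (h :* con (+ 0))) :+ t :* ((h :+ h) :* (k :* v :* w) :+ con (+ 0))
                   :+ h :* (k :* v :* (w :* e)) :+ h :* con (+ 0) :+ h :* con (+ 0))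
               refl ½ k (b - a) w e τ a ⟩
          combination 0# ((½ + ½) * (k * (b - a) * w)) 0# (k * (b - a) * (w * e)) 0# 0#
            ≈⟨ combination-cong
                 (if-no mid? mid⇒⊥)
                 (trans (if-yes low? τ≤a) (sym (½-twice _)))
                 (if-no mid? mid⇒⊥)
                 (trans (if-yes low? τ≤a) (*-congˡ (solve 2 (λ c d → d :* d :- c :* c :=
                      (d :- c) :* (d :+ c)) refl c d)))
                 (if-no mid? mid⇒⊥)
                 (if-no high? λ b≤τ → <⇒≱ a<b (≤.trans b≤τ τ≤a)) ⟨
          _ ∎
          where
          mid⇒⊥ : ¬ (a < τ × τ < b)
          mid⇒⊥ (a<τ , _) = <⇒≱ a<τ τ≤a
        by-position (no τ≰a) (yes b≤τ) = begin-equality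
          contribution (clip a b τ)
            ≈⟨ contribution-factored (clip-above a≤b b≤τ) ⟩
          k * (w * (½ * (b ² - a ²)) + (b - b) * (½ * (w * (τ + τ + e))))
            ≈⟨ solve 7 (λ h k a b w e t →
                 k :* (w :* (h :* (b :* b :- a :* a)) :+ (b :- b) :* (h :* (w :* (t :+ t :+ e)))) :=
                 t :* t :* (:- (h :* con (+ 0))) :+ t :* (con (+ 0) :+ con (+ 0))
                   :+ h :* con (+ 0) :+ h :* con (+ 0) :+ h :* (k :* (b :* b :- a :* a) :* w))
               refl ½ k a b w e τ ⟩
          combination 0# 0# 0# 0# 0# (k * (b ² - a ²) * w)
            ≈⟨ combination-cong (if-no mid? mid⇒⊥) (if-no low? τ≰a) (if-no mid? mid⇒⊥)
                 (if-no low? τ≰a) (if-no mid? mid⇒⊥) (if-yes high? b≤τ) ⟨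
          _ ∎
          where
          mid⇒⊥ : ¬ (a < τ × τ < b)
          mid⇒⊥ (_ , τ<b) = <⇒≱ τ<b b≤τ
        by-position (no τ≰a) (no b≰τ) = begin-equality
          contribution (clip a b τ)
            ≈⟨ contribution-factored (clip-inside a≤b (proj₁ (≰⇒> τ≰a)) (proj₁ (≰⇒> b≰τ))) ⟩
          k * (w * (½ * (τ ² - a ²)) + (b - τ) * (½ * (w * (τ + τ + e))))
            ≈⟨ solve 7 (λ h k a b w e t →
                 k :* (w :* (h :* (t :* t :- a :* a)) :+ (b :- t) :* (h :* (w :* (t :+ t :+ e)))) :=
                 t :* t :* (:- (h :* (k :* w))) :+ t :* (con (+ 0) :+ k :* ((h :+ h) :* b :- h :* e) :* w)
                   :+ h :* con (+ 0) :+ h :* (k :* (b :* e :- a :* a) :* w) :+ h :* con (+ 0))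
               refl ½ k a b w e τ ⟩
          combination (k * w) 0# (k * ((½ + ½) * b - ½ * e) * w) 0# (k * (b * e - a ²) * w) 0#
            ≈⟨ combination-cong (if-yes mid? mid) (if-no low? τ≰a)
                 (trans (if-yes mid? mid) (*-congʳ (*-congˡ (+-congʳ (sym (½-twice b))))))
                 (if-no low? τ≰a) (if-yes mid? mid) (if-no high? b≰τ) ⟨
          _ ∎
          where
          mid : a < τ × τ < b
          mid = ≰⇒> τ≰a , ≰⇒> b≰τ

theorem2 :
    ExcludedMiddle 0ℓ →
    (ℛ : CompleteOrderedField) →
    ∀ {o ℓ} (𝒫 : ProbabilitySpace ℛ o ℓ) →
    let open CompleteOrderedField ℛ
        open ProbabilitySpace 𝒫
        open Probability 𝒫
    in
    ∀ (N : ℕ.ℕ) → 1 ℕ.≤ N →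
    (k a b c d : Fin N → ℝ) →
    (∀ n → 0# ≤ a n × a n < b n) →
    (∀ n → 0# ≤ c n × c n < d n) →
    (∀ n → 0# < k n) →
    sum (λ n → k n * (b n - a n) * (d n - c n)) ≈ 1# →
    (π₁ π₂ : Ω → ℝ) →
    IsRandomVariable π₁ → IsRandomVariable π₂ →
    (∀ ω → 0# ≤ π₁ ω) → (∀ ω → 0# ≤ π₂ ω) →
    HasJointDensity π₁ π₂ (λ x y → sum (λ n →
      k n * indicator (a n ≤? x ×-dec x <? b n) * indicator (c n ≤? y ×-dec y <? d n))) →
    ∀ (τ₁ : ℝ) → 0# ≤ τ₁ →
    HasExpectation (derivedTime π₁ π₂ τ₁)
      ( τ₁ ² * (- (½ * sumWhere (λ n → a n <? τ₁ ×-dec τ₁ <? b n)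
                         (λ n → k n * (d n - c n))))
      + τ₁ * ( sumWhere (λ n → τ₁ ≤? a n)
                 (λ n → k n * (b n - a n) * (d n - c n))
             + sumWhere (λ n → a n <? τ₁ ×-dec τ₁ <? b n)
                 (λ n → k n * (b n - ½ * (d n + c n)) * (d n - c n)) )
      + ½ * sumWhere (λ n → τ₁ ≤? a n)
              (λ n → k n * (b n - a n) * (d n ² - c n ²))
      + ½ * sumWhere (λ n → a n <? τ₁ ×-dec τ₁ <? b n)
              (λ n → k n * (b n * (d n + c n) - a n ²) * (d n - c n))
      + ½ * sumWhere (λ n → b n ≤? τ₁)
              (λ n → k n * (b n ² - a n ²) * (d n - c n)) )
theorem2 em ℛ 𝒫 N 1≤N k a b c d 0≤a<b 0≤c<d 0<k total π₁ π₂ mπ₁ mπ₂ 0≤π₁ 0≤π₂ density τ 0≤τ =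
  hasExpectation-resp
    -- `sumWhere` unfolds to a `sum` of conditionals, so the stated formula is literally
    -- `combination` applied to six sums.
    (trans (sum-cong λ n → contribution≈combination τ (proj₂ (0≤a<b n)))
      (sym (combination-sum τ {N} _ _ _ _ _ _)))
    (derivedTime-expectation 0≤a<b 0≤c<d 0<k total density)
  where
  open CompleteOrderedField ℛ using (trans; sym)
  open OrderedField ℛ using (sum-cong)
  open ClosedForm em ℛ
  open Expectation em 𝒫
  open DerivedTimeMean em 𝒫
  open DerivedTime mπ₁ mπ₂ 0≤π₁ 0≤π₂ 0≤τ
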